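{- For every prime $p>3$, $$ \sum_{k=0}^{p-1}\frac{(\frac14)_k(\frac12)_k(\frac34)_k}{k!^3\,9^k}\,(8k+1) \equiv p\biggl(\frac{ -3}p\biggr)\pmod{p^3}, $$ equivalently $$ \sum_{k=0}^{p-1}\frac{\binom{4k}{2k}{\binom{2k}{k}}^2}{2^{8k}3^{2k}}\,(8k+1)\equiv p\biggl(\frac{ -3}p\biggr)\pmod{p^3}. $$
   Context: $(a)_k=\prod_{j=0}^{k-1}(a+j)$ is the Pochhammer symbol. $\bigl(\frac{ -3}{p}\bigr)$ is the Legendre (Jacobi--Kronecker) symbol. The left-hand side is a rational number whose denominator involves only the primes $2$ and $3$, so the congruence is understood in $\mathbb Z/p^3\mathbb Z$. -}

module Defs where

open import Data.Nat as ℕ using (ℕ; zero; suc)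
open import Data.Nat.Base using (_!)
open import Data.Nat.Properties using (_!≢0)
open import Data.Integer.DivMod using (_%ℕ_)
open import Data.Integer as ℤ using (ℤ; +_; -[1+_])
open import Data.Integer.Divisibility using () renaming (_∣_ to _∣ℤ_)
open import Data.Rational as ℚ using (ℚ; ↥_; ↧ₙ_; _/_; 0ℚ; 1ℚ)
open import Data.Nat.Coprimality using (Coprime)
open import Data.List using (List; upTo)
open import Data.Bool.ListAction using (any)
open import Data.Bool using (Bool; true; false; if_then_else_)
open import Data.Product using (_×_)

sumℚ : ℕ → (ℕ → ℚ) → ℚ
sumℚ zero    f = 0ℚ
sumℚ (suc n) f = sumℚ n f ℚ.+ f n

_^ℚ_ : ℚ → ℕ → ℚ
x ^ℚ zero  = 1ℚ
x ^ℚ suc n = x ℚ.* (x ^ℚ n)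

poch : ℚ → ℕ → ℚ
poch a zero    = 1ℚ
poch a (suc k) = poch a k ℚ.* (a ℚ.+ ((+ k) / 1))

invFact : ℕ → ℚ
invFact k = (+ 1 / (k !)) {{k !≢0}}

ℕ→ℚ : ℕ → ℚ
ℕ→ℚ n = (+ n) / 1

-- congruence of rationals modulo a positive integer m (in ℤ localised
-- away from m): r - s = a/b in lowest terms with m ∣ a and gcd(b,m) = 1.
_≡_[modℚ_] : ℚ → ℚ → ℕ → Set
r ≡ s [modℚ m ] = ((+ m) ∣ℤ (↥ (r ℚ.- s))) × Coprime (↧ₙ (r ℚ.- s)) m

-- Legendre symbol (a / p) for a prime p:
--   0 if p ∣ a, 1 if a is a nonzero square mod p, -1 otherwise.
-- (The value at p = 0 is a junk value and never used.)
legendre : ℤ → ℕ → ℤ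
legendre a zero = + 0
legendre a p@(suc _) =
  if isZero (a %ℕ p) then + 0
  else if any (λ x → isZero (((+ x) ℤ.* (+ x) ℤ.- a) %ℕ p)) (upTo p)
       then + 1 else -[1+ 0 ]
  where
  isZero : ℕ → Bool
  isZero zero    = true
  isZero (suc _) = false

{-# OPTIONS --safe #-}
-- Put X = x² and t_k(X) = ∏_{j<k} (4j+1)(4j+3)((2j+1)²-X) / (8(2j+1)(j+1)((6j+6)²-X)), and let
-- S(X) be the sum of (8k+1) t_k(X) over k < p; the sum in question is S(0).  A Wilf–Zeilberger pair
-- for x → x + 6 gives S(x²) = x χ(x) exactly for odd 0 < x < 2p, where χ(x) = 1, 0, -1 for
-- x ≡ 1, 3, 5 mod 6.  Since t_k(X) ∏_{0<i<p} ((6i)²-X) is a polynomial of degree p-1 in X, Lagrange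
-- interpolation at the p nodes x² expresses S(0) as a combination of the values S(x²) with weights that
-- do not depend on k.  For x ≠ p the weight is divisible by p³: two of the factors (6i)²-x² are divisible
-- by p, the node p² contributes p², and only one difference of nodes is divisible by p.  The weight of
-- x = p is 1 modulo p², so S(0) ≡ S(p²) = p χ(p) modulo p³.  Finally χ(p) is the Legendre symbol
-- of -3, by counting the fixed points of permutations of order 3 of the residues modulo p.
module Submission where

open import Defs
open import Data.Nat as ℕ using (ℕ; zero; suc; _≤_; _≡ᵇ_; _<_; _∸_; _^_)
open import Data.Nat.Primality using (Prime; euclidsLemma; prime⇒irreducible; prime⇒nonTrivial)
open import Data.Integer as ℤ using (ℤ; +_; -[1+_])
open import Data.Rational as ℚ using (ℚ; _/_; 0ℚ; 1ℚ; _+_; _*_; _-_; -_)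

import Data.Nat.Properties
open import Algebra.Properties.CommutativeMonoid.Sum Data.Nat.Properties.+-0-commutativeMonoid
  using (sum; sum-permute; ∑-distrib-+; sum-cong-≗; sum-replicate-zero)
open import Data.Bool using (Bool; true; false; if_then_else_; _∨_; T)
open import Data.Bool.ListAction using (any; or)
open import Data.Empty using (⊥-elim)
open import Data.Fin using (Fin; zero; suc; toℕ; fromℕ<)
open import Data.Fin.Permutation using (permutation)
import Data.Fin.Properties as Finₚ
open import Data.Integer.DivMod using (_%ℕ_; _/ℕ_; n%ℕd<d; a≡a%ℕn+[a/ℕn]*n)
open import Data.Integer.Divisibility.Signed using (_∣_; divides; ∣ᵤ⇒∣; ∣⇒∣ᵤ)
import Data.Integer.Divisibility.Signed as ℤ∣
import Data.Integer.Properties as ℤₚ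
import Data.Integer.Tactic.RingSolver as ℤ-Solver
open import Data.List using (upTo; applyUpTo)
open import Data.List.Properties using (map-cong)
open import Data.Maybe using (Maybe; just; nothing)
open import Data.Nat.Base using (_!)
open import Data.Nat.Coprimality using (Coprime; coprime-divisor; coprime-Bézout; recompute)
import Data.Nat.Coprimality as Coprimality
import Data.Nat.Divisibility as ℕ∣
open import Data.Nat.DivMod using (_%_; m≡m%n+[m/n]*n; m%n<n; [m+kn]%n≡m%n)
open import Data.Nat.GCD using (module Bézout)
import Data.Nat.Properties as ℕₚ
import Data.Nat.Tactic.RingSolver as ℕ-Solver
open import Data.Product using (∃; _×_; _,_; proj₁; proj₂)
import Data.Rational.Properties as ℚₚ
import Data.Rational.Unnormalised as ℚᵘ
import Data.Rational.Unnormalised.Properties as ℚᵘₚ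
open import Data.Sum using (_⊎_; inj₁; inj₂; [_,_]′)
import Data.Sum as Sum
open import Relation.Binary.Definitions using (Tri; tri<; tri≈; tri>)
open import Relation.Binary.PropositionalEquality
open import Relation.Nullary using (¬_; Dec; yes; no; contradiction)
open import Tactic.RingSolver using (solve-∀)
open import Tactic.RingSolver.Core.AlmostCommutativeRing using (AlmostCommutativeRing; fromCommutativeRing)
open ℚᵘₚ using (≃-trans; ≃-sym)
open ≡-Reasoning

-- The shift is 6 because x → x + 6 moves the factors 6j+6 ± x of t_k by one index and the factors
-- 2j+1 ± x by three; a smaller even shift would move 6j+6 ± x by a fraction of an index, and t_k at
-- the two arguments would no longer differ by a rational function of k. For odd x no (6i)² - x²
-- vanishes, and t_k(x²) = 0 once 2k > x, so S(x²) does not notice where the sum is cut. A termwise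
-- reduction modulo p fails because t_k(x²) can have p in its denominator. Interpolation avoids
-- this: only the whole sums S(x²) enter, and these are integers. At the node x = p the exponent 3
-- splits as 2 + 1: the weight is known modulo p² only, and S(p²) = p χ(p) supplies the last factor
-- p. The symbol of -3 needs both directions. A square root of -3 yields a cube root of unity, whose
-- multiplication map fixes only 0, so p ≡ 1 modulo 3; without one, i ↦ 1/(1-i) fixes only the two
-- residues added by hand, so p ≡ 2.

ℚ-ring : AlmostCommutativeRing _ _
ℚ-ring = fromCommutativeRing ℚₚ.+-*-commutativeRing isZero?
  where
  isZero? : (x : ℚ) → Maybe (0ℚ ≡ x)
  isZero? x with 0ℚ ℚₚ.≟ x
  ... | yes p = just p
  ... | no _  = nothing

-- Integers inside the rationals, and total division.

ι : ℤ → ℚ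
ι i = i / 1

ι-toℚᵘ : ∀ i → ℚ.toℚᵘ (ι i) ℚᵘ.≃ ℚᵘ.mkℚᵘ i 0
ι-toℚᵘ i = ℚₚ.toℚᵘ-fromℚᵘ (ℚᵘ.mkℚᵘ i 0)

ι-injective : ∀ {i j} → ι i ≡ ι j → i ≡ j
ι-injective {i} {j} eq with ℚₚ.fromℚᵘ-injective {ℚᵘ.mkℚᵘ i 0} {ℚᵘ.mkℚᵘ j 0} eq
... | ℚᵘ.*≡* h = trans (sym (ℤₚ.*-identityʳ i)) (trans h (ℤₚ.*-identityʳ j))

ι-+ : ∀ i j → ι (i ℤ.+ j) ≡ ι i + ι j
ι-+ i j = ℚₚ.toℚᵘ-injective (≃-trans (ι-toℚᵘ (i ℤ.+ j)) (≃-trans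
  (ℚᵘ.*≡* (cong (ℤ._* + 1) (cong₂ ℤ._+_ (sym (ℤₚ.*-identityʳ i)) (sym (ℤₚ.*-identityʳ j)))))
  (≃-trans (ℚᵘₚ.+-cong (≃-sym (ι-toℚᵘ i)) (≃-sym (ι-toℚᵘ j))) (≃-sym (ℚₚ.toℚᵘ-homo-+ (ι i) (ι j))))))

ι-* : ∀ i j → ι (i ℤ.* j) ≡ ι i * ι j
ι-* i j = ℚₚ.toℚᵘ-injective (≃-trans (ι-toℚᵘ (i ℤ.* j))
  (≃-trans (ℚᵘₚ.*-cong (≃-sym (ι-toℚᵘ i)) (≃-sym (ι-toℚᵘ j))) (≃-sym (ℚₚ.toℚᵘ-homo-* (ι i) (ι j)))))

ι-neg : ∀ i → ι (ℤ.- i) ≡ - ι i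
ι-neg i = begin
  ι (ℤ.- i)                      ≡⟨ lem (ι (ℤ.- i)) (ι i) ⟩
  (ι (ℤ.- i) + ι i) - ι i        ≡⟨ cong (_- ι i) (sym (ι-+ (ℤ.- i) i)) ⟩
  ι (ℤ.- i ℤ.+ i) - ι i          ≡⟨ cong (λ z → ι z - ι i) (ℤₚ.+-inverseˡ i) ⟩
  0ℚ - ι i                       ≡⟨ ℚₚ.+-identityˡ (- ι i) ⟩
  - ι i                          ∎
  where
  lem : ∀ a b → a ≡ (a + b) - b
  lem = solve-∀ ℚ-ring

-- Junk value: inv 0 = 1, so that a factor inv (x j - x j) drops out of a product.
inv : ℚ → ℚ
inv q with q ℚₚ.≟ 0ℚ
... | yes _  = 1ℚ
... | no q≢0 = ℚ.1/_ q {{ℚ.≢-nonZero q≢0}}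

inv-inverseʳ : ∀ {q} → q ≢ 0ℚ → q * inv q ≡ 1ℚ
inv-inverseʳ {q} q≢0 with q ℚₚ.≟ 0ℚ
... | yes q≡0 = contradiction q≡0 q≢0
... | no q≢0′ = ℚₚ.*-inverseʳ q {{ℚ.≢-nonZero q≢0′}}

ι-≢0 : ∀ {i} → i ≢ + 0 → ι i ≢ 0ℚ
ι-≢0 i≢0 eq = i≢0 (ι-injective eq)

*-cancelʳ : ∀ {a b d} → d ≢ 0ℚ → a * d ≡ b * d → a ≡ b
*-cancelʳ {a} {b} {d} d≢0 eq = begin
  a                ≡⟨ expand a ⟩
  a * d * inv d    ≡⟨ cong (_* inv d) eq ⟩
  b * d * inv d    ≡⟨ sym (expand b) ⟩
  b                ∎
  where
  expand : ∀ c → c ≡ c * d * inv d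
  expand c = sym (trans (ℚₚ.*-assoc c d (inv d))
    (trans (cong (c *_) (inv-inverseʳ d≢0)) (ℚₚ.*-identityʳ c)))

*-≢0 : ∀ {a b} → a ≢ 0ℚ → b ≢ 0ℚ → a * b ≢ 0ℚ
*-≢0 {a} {b} a≢0 b≢0 eq = a≢0 (*-cancelʳ b≢0 (trans eq (sym (ℚₚ.*-zeroˡ b))))

*-inv-unique : ∀ {a c d} → d ≢ 0ℚ → a ≡ c * d → a * inv d ≡ c
*-inv-unique {a} {c} {d} d≢0 eq = *-cancelʳ d≢0 (begin
  a * inv d * d    ≡⟨ lem a (inv d) d ⟩
  a * (d * inv d)  ≡⟨ cong (a *_) (inv-inverseʳ d≢0) ⟩
  a * 1ℚ           ≡⟨ trans (ℚₚ.*-identityʳ a) eq ⟩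
  c * d            ∎)
  where
  lem : ∀ a c d → a * c * d ≡ a * (d * c)
  lem = solve-∀ ℚ-ring

-- Finite sums and products, partial fractions

sum-cong : ∀ n {f g} → (∀ {i} → i < n → f i ≡ g i) → sumℚ n f ≡ sumℚ n g
sum-cong zero    eq = refl
sum-cong (suc n) eq = cong₂ _+_ (sum-cong n (λ i<n → eq (ℕₚ.m<n⇒m<1+n i<n))) (eq ℕₚ.≤-refl)

sum-*ʳ : ∀ n f c → sumℚ n f * c ≡ sumℚ n (λ i → f i * c)
sum-*ʳ zero    f c = ℚₚ.*-zeroˡ c
sum-*ʳ (suc n) f c = trans (ℚₚ.*-distribʳ-+ c (sumℚ n f) (f n)) (cong (_+ f n * c) (sum-*ʳ n f c))

sum-+ : ∀ n f g → sumℚ n f + sumℚ n g ≡ sumℚ n (λ i → f i + g i)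
sum-+ zero    f g = refl
sum-+ (suc n) f g = trans (interchange (sumℚ n f) (f n) (sumℚ n g) (g n)) (cong (_+ (f n + g n)) (sum-+ n f g))
  where
  interchange : ∀ a b c d → a + b + (c + d) ≡ a + c + (b + d)
  interchange = solve-∀ ℚ-ring

sum-0 : ∀ n → sumℚ n (λ _ → 0ℚ) ≡ 0ℚ
sum-0 zero    = refl
sum-0 (suc n) = trans (ℚₚ.+-identityʳ _) (sum-0 n)

sum-comm : ∀ m n (f : ℕ → ℕ → ℚ) →
  sumℚ m (λ i → sumℚ n (λ j → f i j)) ≡ sumℚ n (λ j → sumℚ m (λ i → f i j))
sum-comm zero    n f = sym (sum-0 n)
sum-comm (suc m) n f = trans (cong (_+ sumℚ n (f m)) (sum-comm m n f))
  (sum-+ n (λ j → sumℚ m (λ i → f i j)) (f m))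

sum-vanish : ∀ n r f → (∀ i → f (n ℕ.+ i) ≡ 0ℚ) → sumℚ (n ℕ.+ r) f ≡ sumℚ n f
sum-vanish n zero    f eq = cong (λ m → sumℚ m f) (ℕₚ.+-identityʳ n)
sum-vanish n (suc r) f eq = trans (cong (λ m → sumℚ m f) (ℕₚ.+-suc n r))
  (trans (cong₂ _+_ (sum-vanish n r f eq) (eq r)) (ℚₚ.+-identityʳ _))

prod : ℕ → (ℕ → ℚ) → ℚ
prod zero    f = 1ℚ
prod (suc n) f = prod n f * f n

prod-cong : ∀ n {f g} → (∀ {i} → i < n → f i ≡ g i) → prod n f ≡ prod n g
prod-cong zero    eq = refl
prod-cong (suc n) eq = cong₂ _*_ (prod-cong n (λ i<n → eq (ℕₚ.m<n⇒m<1+n i<n))) (eq ℕₚ.≤-refl)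

module PartialFractions
  (a x : ℕ → ℚ) (distinct : ∀ {i j} → i ≢ j → x i - x j ≢ 0ℚ) where

  residue : ℕ → ℕ → ℚ
  residue n l = prod n (λ i → a i - x l) * prod (suc n) (λ j → inv (x j - x l))

  private
    -- (a-y)/((x-y)(z-y)) split at its two poles x and z.
    split : ∀ {x z y} a → x - z ≢ 0ℚ → x - y ≢ 0ℚ → z - y ≢ 0ℚ →
      inv (x - y) * ((a - y) * inv (z - y)) ≡
      (a - x) * inv (z - x) * inv (x - y) + inv (x - z) * ((a - z) * inv (z - y))
    split {x} {z} {y} a x≢z x≢y z≢y = begin
      X * ((a - y) * Z)                        ≡⟨ sym (ℚₚ.*-identityʳ _) ⟩
      X * ((a - y) * Z) * 1ℚ                   ≡⟨ cong (X * ((a - y) * Z) *_) (sym (inv-inverseʳ x≢z)) ⟩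
      X * ((a - y) * Z) * ((x - z) * D)        ≡⟨ lem₁ x y z a X Z D ⟩
      X * D * (a - z) * ((x - y) * Z) - (a - x) * X * D * ((z - y) * Z) + (a - z) * Z * D * ((x - y) * X) - X * D * (a - z) * ((x - y) * Z)
        ≡⟨ cong₂ (λ u v → X * D * (a - z) * ((x - y) * Z) - (a - x) * X * D * u + (a - z) * Z * D * v - X * D * (a - z) * ((x - y) * Z))
             (inv-inverseʳ z≢y) (inv-inverseʳ x≢y) ⟩
      X * D * (a - z) * ((x - y) * Z) - (a - x) * X * D * 1ℚ + (a - z) * Z * D * 1ℚ - X * D * (a - z) * ((x - y) * Z)
        ≡⟨ lem₂ x y z a X Z D ⟩
      (a - x) * (- D) * X + D * ((a - z) * Z)  ≡⟨ cong (λ e → (a - x) * e * X + D * ((a - z) * Z)) (sym inv-flip) ⟩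
      (a - x) * inv (z - x) * X + D * ((a - z) * Z) ∎
      where
      X = inv (x - y)
      Z = inv (z - y)
      D = inv (x - z)
      lem₁ : ∀ x y z a X Z D → X * ((a - y) * Z) * ((x - z) * D) ≡
        X * D * (a - z) * ((x - y) * Z) - (a - x) * X * D * ((z - y) * Z) + (a - z) * Z * D * ((x - y) * X) - X * D * (a - z) * ((x - y) * Z)
      lem₁ = solve-∀ ℚ-ring
      lem₂ : ∀ x y z a X Z D →
        X * D * (a - z) * ((x - y) * Z) - (a - x) * X * D * 1ℚ + (a - z) * Z * D * 1ℚ - X * D * (a - z) * ((x - y) * Z) ≡
        (a - x) * (- D) * X + D * ((a - z) * Z)
      lem₂ = solve-∀ ℚ-ring
      neg : ∀ x z → z - x ≡ - (x - z)
      neg = solve-∀ ℚ-ring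
      z≢x : z - x ≢ 0ℚ
      z≢x eq = x≢z (trans (neg z x) (cong -_ eq))
      lem₃ : ∀ x z D → (x - z) * D ≡ (- D) * (z - x)
      lem₃ = solve-∀ ℚ-ring
      inv-flip : inv (z - x) ≡ - D
      inv-flip = trans (sym (ℚₚ.*-identityˡ _)) (*-inv-unique z≢x
        (trans (sym (inv-inverseʳ x≢z)) (lem₃ x z D)))

  -- Induction on the number of poles. A new pole `z` multiplies both sides by
  -- `(a n - y) / (z - y)`; `split` turns each old residue into the next one, and the coefficients
  -- collected at `z` add up to the induction hypothesis evaluated at `y = z`.
  partial-fractions : ∀ n y → (∀ {j} → j < suc n → x j - y ≢ 0ℚ) →
    prod n (λ i → a i - y) * prod (suc n) (λ j → inv (x j - y)) ≡
    sumℚ (suc n) (λ l → residue n l * inv (x l - y))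
  partial-fractions zero y y≢ = sym (begin
    0ℚ + 1ℚ * (1ℚ * inv (x 0 - x 0)) * inv (x 0 - y)
      ≡⟨ cong (λ v → 0ℚ + 1ℚ * (1ℚ * inv v) * inv (x 0 - y)) (ℚₚ.+-inverseʳ (x 0)) ⟩
    0ℚ + 1ℚ * (1ℚ * 1ℚ) * inv (x 0 - y)
      ≡⟨ lem (inv (x 0 - y)) ⟩
    1ℚ * (1ℚ * inv (x 0 - y)) ∎)
    where
    lem : ∀ X → 0ℚ + 1ℚ * (1ℚ * 1ℚ) * X ≡ 1ℚ * (1ℚ * X)
    lem = solve-∀ ℚ-ring
  partial-fractions (suc n) y y≢ = begin
    A y * (a n - y) * (B y * inv (z - y))      ≡⟨ lem₁ (A y) (a n - y) (B y) (inv (z - y)) ⟩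
    A y * B y * ((a n - y) * inv (z - y))
      ≡⟨ cong (_* ((a n - y) * inv (z - y))) (partial-fractions n y (λ j<n → y≢ (ℕₚ.m<n⇒m<1+n j<n))) ⟩
    sumℚ (suc n) (λ l → residue n l * inv (x l - y)) * ((a n - y) * inv (z - y))
      ≡⟨ sum-*ʳ (suc n) _ _ ⟩
    sumℚ (suc n) (λ l → residue n l * inv (x l - y) * ((a n - y) * inv (z - y)))
      ≡⟨ sum-cong (suc n) splitTerm ⟩
    sumℚ (suc n) (λ l → residue (suc n) l * inv (x l - y) + residue n l * inv (x l - z) * E)
      ≡⟨ sym (sum-+ (suc n) _ _) ⟩
    sumℚ (suc n) (λ l → residue (suc n) l * inv (x l - y)) + sumℚ (suc n) (λ l → residue n l * inv (x l - z) * E)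
      ≡⟨ cong (λ v → sumℚ (suc n) (λ l → residue (suc n) l * inv (x l - y)) + v) newResidue ⟩
    sumℚ (suc n) (λ l → residue (suc n) l * inv (x l - y)) + residue (suc n) (suc n) * inv (z - y) ∎
    where
    z = x (suc n)
    A B : ℚ → ℚ
    A y = prod n (λ i → a i - y)
    B y = prod (suc n) (λ j → inv (x j - y))
    E = (a n - z) * inv (z - y)
    lem₁ : ∀ p q r s → p * q * (r * s) ≡ p * r * (q * s)
    lem₁ = solve-∀ ℚ-ring
    lem₂ : ∀ p q r s u v w → p * q * (r * s * u + v * w) ≡ p * r * (q * s) * u + p * q * v * w
    lem₂ = solve-∀ ℚ-ring
    lem₃ : ∀ p q r s → p * q * (r * s) ≡ p * r * (q * 1ℚ) * s
    lem₃ = solve-∀ ℚ-ring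
    splitTerm : ∀ {l} → l < suc n →
      residue n l * inv (x l - y) * ((a n - y) * inv (z - y)) ≡
      residue (suc n) l * inv (x l - y) + residue n l * inv (x l - z) * E
    splitTerm {l} l<n = begin
      residue n l * inv (x l - y) * ((a n - y) * inv (z - y))  ≡⟨ ℚₚ.*-assoc (residue n l) _ _ ⟩
      residue n l * (inv (x l - y) * ((a n - y) * inv (z - y)))
        ≡⟨ cong (residue n l *_) (split (a n) (distinct (ℕₚ.<⇒≢ l<n)) (y≢ (ℕₚ.m<n⇒m<1+n l<n)) (y≢ ℕₚ.≤-refl)) ⟩
      residue n l * ((a n - x l) * inv (z - x l) * inv (x l - y) + inv (x l - z) * E)
        ≡⟨ lem₂ (A (x l)) (B (x l)) (a n - x l) (inv (z - x l)) (inv (x l - y)) (inv (x l - z)) E ⟩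
      residue (suc n) l * inv (x l - y) + residue n l * inv (x l - z) * E ∎
    newResidue : sumℚ (suc n) (λ l → residue n l * inv (x l - z) * E) ≡ residue (suc n) (suc n) * inv (z - y)
    newResidue = begin
      sumℚ (suc n) (λ l → residue n l * inv (x l - z) * E)   ≡⟨ sym (sum-*ʳ (suc n) _ E) ⟩
      sumℚ (suc n) (λ l → residue n l * inv (x l - z)) * E
        ≡⟨ cong (_* E) (sym (partial-fractions n z (λ j<n → distinct (ℕₚ.<⇒≢ j<n)))) ⟩
      A z * B z * E                                          ≡⟨ lem₃ (A z) (B z) (a n - z) (inv (z - y)) ⟩
      A z * (a n - z) * (B z * inv 0ℚ) * inv (z - y)
        ≡⟨ cong (λ v → A z * (a n - z) * (B z * inv v) * inv (z - y)) (sym (ℚₚ.+-inverseʳ z)) ⟩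
      residue (suc n) (suc n) * inv (z - y) ∎

ℕ→ℚ-suc : ∀ n → ℕ→ℚ (suc n) ≡ ℕ→ℚ n + 1ℚ
ℕ→ℚ-suc n = trans (cong ℕ→ℚ (ℕₚ.+-comm 1 n)) (ι-+ (+ n) (+ 1))

ℕ→ℚ-+ : ∀ m n → ℕ→ℚ (m ℕ.+ n) ≡ ℕ→ℚ m + ℕ→ℚ n
ℕ→ℚ-+ m n = ι-+ (+ m) (+ n)

ℕ→ℚ-* : ∀ m n → ℕ→ℚ (m ℕ.* n) ≡ ℕ→ℚ m * ℕ→ℚ n
ℕ→ℚ-* m n = trans (cong ι (ℤₚ.pos-* m n)) (ι-* (+ m) (+ n))

ℕ→ℚ-≢0 : ∀ n → ℕ→ℚ (suc n) ≢ 0ℚ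
ℕ→ℚ-≢0 n = ι-≢0 {+ suc n} (λ ())

*-inv-cross : ∀ a b {c d} → c ≢ 0ℚ → d ≢ 0ℚ → a * d ≡ b * c → a * inv c ≡ b * inv d
*-inv-cross a b {c} {d} c≢0 d≢0 eq = *-inv-unique c≢0 (begin
  a                    ≡⟨ sym (*-inv-unique d≢0 (sym eq)) ⟩
  b * c * inv d        ≡⟨ lem b c (inv d) ⟩
  b * inv d * c        ∎)
  where
  lem : ∀ b c d → b * c * d ≡ b * d * c
  lem = solve-∀ ℚ-ring

-- The parametric sum and its values at odd squares

oddSq sixSq coef : ℕ → ℚ
oddSq k = (ℕ→ℚ 2 * ℕ→ℚ k + 1ℚ) * (ℕ→ℚ 2 * ℕ→ℚ k + 1ℚ)
sixSq k = (ℕ→ℚ 6 * ℕ→ℚ k + ℕ→ℚ 6) * (ℕ→ℚ 6 * ℕ→ℚ k + ℕ→ℚ 6)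
coef k = (ℕ→ℚ 4 * ℕ→ℚ k + 1ℚ) * (ℕ→ℚ 4 * ℕ→ℚ k + ℕ→ℚ 3)
  * inv (ℕ→ℚ 8 * ((ℕ→ℚ 2 * ℕ→ℚ k + 1ℚ) * (ℕ→ℚ k + 1ℚ)))

-- At X = 0 this is the summand of the theorem without the factor 8k+1; at X = (2l+1)² it vanishes for k > l.
term : ℚ → ℕ → ℚ
term X zero    = 1ℚ
term X (suc k) = term X k * (coef k * ((oddSq k - X) * inv (sixSq k - X)))

series : ℚ → ℕ → ℚ
series X M = sumℚ M (λ k → (ℕ→ℚ 8 * ℕ→ℚ k + 1ℚ) * term X k)

2k+1≢0 : ∀ k → ℕ→ℚ 2 * ℕ→ℚ k + 1ℚ ≢ 0ℚ
2k+1≢0 k eq = ℕ→ℚ-≢0 (2 ℕ.* k) (trans (trans (ℕ→ℚ-suc (2 ℕ.* k)) (cong (_+ 1ℚ) (ℕ→ℚ-* 2 k))) eq)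

k+1≢0 : ∀ k → ℕ→ℚ k + 1ℚ ≢ 0ℚ
k+1≢0 k eq = ℕ→ℚ-≢0 k (trans (ℕ→ℚ-suc k) eq)

coefDenominator≢0 : ∀ k → ℕ→ℚ 8 * ((ℕ→ℚ 2 * ℕ→ℚ k + 1ℚ) * (ℕ→ℚ k + 1ℚ)) ≢ 0ℚ
coefDenominator≢0 k = *-≢0 (ℕ→ℚ-≢0 7) (*-≢0 (2k+1≢0 k) (k+1≢0 k))

-- A Wilf–Zeilberger pair for the shift x → x + 6, where X = x².  Both terms are multiples of one
-- hypergeometric term, term (x²) k = x Q(k) u(k) and term ((x+6)²) k = (x+6) P(k) u(k), and
-- (8k+1) (P(k) - Q(k)) u(k) telescopes.
module Shift (x : ℚ) (x+i≢0 : ∀ i → x + ℕ→ℚ i ≢ 0ℚ) (6n-x≢0 : ∀ n → ℕ→ℚ 6 * ℕ→ℚ n - x ≢ 0ℚ) where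

  x≢0 : x ≢ 0ℚ
  x≢0 eq = x+i≢0 0 (trans (ℚₚ.+-identityʳ x) eq)

  6n+x≢0 : ∀ n → ℕ→ℚ 6 * ℕ→ℚ n + x ≢ 0ℚ
  6n+x≢0 n eq = x+i≢0 (6 ℕ.* n) (trans (ℚₚ.+-comm x _) (trans (cong (_+ x) (ℕ→ℚ-* 6 n)) eq))

  -- The reflection x ↦ -6 - x exchanges x² with (x+6)², and `P` with `Q`.
  P Q : ℚ → ℚ
  P N = (ℕ→ℚ 2 * N + 1ℚ + x) * (ℕ→ℚ 2 * N + ℕ→ℚ 3 + x) * (ℕ→ℚ 2 * N + ℕ→ℚ 5 + x) * (ℕ→ℚ 6 * N - x)
  Q N = (ℕ→ℚ 2 * N - ℕ→ℚ 5 - x) * (ℕ→ℚ 2 * N - ℕ→ℚ 3 - x) * (ℕ→ℚ 2 * N - 1ℚ - x) * (ℕ→ℚ 6 * N + ℕ→ℚ 6 + x)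

  -- Of the factors in the two term ratios, `numer` keeps 2N+1-(x+6) and 2N+1+x, and `denom` keeps
  -- 6N+6+(x+6) and 6N+6-x. The others are index shifts of these (by three and by one) and are
  -- accounted for by `P` and `Q`.
  numer denom : ℚ → ℚ
  numer N = (ℕ→ℚ 2 * N - ℕ→ℚ 5 - x) * (ℕ→ℚ 2 * N + 1ℚ + x)
  denom N = (ℕ→ℚ 6 * (N + 1ℚ + 1ℚ) + x) * (ℕ→ℚ 6 * (N + 1ℚ) - x)

  u : ℕ → ℚ
  -- Since x Q(0) = (x+6) P(0), this one constant makes both terms equal to 1 at k = 0.
  u zero    = inv ((x + ℕ→ℚ 6) * P 0ℚ)
  u (suc n) = u n * (coef n * (numer (ℕ→ℚ n) * inv (denom (ℕ→ℚ n))))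

  d₀≢0 : (x + ℕ→ℚ 6) * P 0ℚ ≢ 0ℚ
  d₀≢0 eq = *-≢0 (x+i≢0 6) (*-≢0 (*-≢0 (*-≢0 (x+i≢0 1) (x+i≢0 3)) (x+i≢0 5)) (6n-x≢0 0)) (trans (lem x) eq)
    where
    lem : ∀ x → (x + ℕ→ℚ 6) * ((x + ℕ→ℚ 1) * (x + ℕ→ℚ 3) * (x + ℕ→ℚ 5) * (ℕ→ℚ 6 * ℕ→ℚ 0 - x)) ≡
      (x + ℕ→ℚ 6) * ((ℕ→ℚ 2 * 0ℚ + 1ℚ + x) * (ℕ→ℚ 2 * 0ℚ + ℕ→ℚ 3 + x) * (ℕ→ℚ 2 * 0ℚ + ℕ→ℚ 5 + x) * (ℕ→ℚ 6 * 0ℚ - x))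
    lem = solve-∀ ℚ-ring

  suc≡ : ∀ n → ℕ→ℚ n + 1ℚ ≡ ℕ→ℚ (suc n)
  suc≡ n = sym (ℕ→ℚ-suc n)

  denom≢0 : ∀ n → denom (ℕ→ℚ n) ≢ 0ℚ
  denom≢0 n = *-≢0
    (λ eq → 6n+x≢0 (suc (suc n)) (trans (cong (λ N → ℕ→ℚ 6 * N + x) (trans (ℕ→ℚ-suc (suc n)) (cong (_+ 1ℚ) (ℕ→ℚ-suc n)))) eq))
    (λ eq → 6n-x≢0 (suc n) (trans (cong (λ N → ℕ→ℚ 6 * N - x) (ℕ→ℚ-suc n)) eq))

  sixSq-x²≢0 : ∀ n → sixSq n - x * x ≢ 0ℚ
  sixSq-x²≢0 n eq = *-≢0 (6n+x≢0 (suc n)) (6n-x≢0 (suc n))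
    (trans (cong (λ N → (ℕ→ℚ 6 * N + x) * (ℕ→ℚ 6 * N - x)) (ℕ→ℚ-suc n)) (trans (lem (ℕ→ℚ n) x) eq))
    where
    lem : ∀ N x → (ℕ→ℚ 6 * (N + 1ℚ) + x) * (ℕ→ℚ 6 * (N + 1ℚ) - x) ≡
      (ℕ→ℚ 6 * N + ℕ→ℚ 6) * (ℕ→ℚ 6 * N + ℕ→ℚ 6) - x * x
    lem = solve-∀ ℚ-ring

  sixSq-[x+6]²≢0 : ∀ n → sixSq n - (x + ℕ→ℚ 6) * (x + ℕ→ℚ 6) ≢ 0ℚ
  sixSq-[x+6]²≢0 n eq = *-≢0 (6n+x≢0 (suc (suc n))) (6n-x≢0 n)
    (trans (cong (λ N → (ℕ→ℚ 6 * N + x) * (ℕ→ℚ 6 * ℕ→ℚ n - x)) (trans (ℕ→ℚ-suc (suc n)) (cong (_+ 1ℚ) (ℕ→ℚ-suc n))))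
      (trans (lem (ℕ→ℚ n) x) eq))
    where
    lem : ∀ N x → (ℕ→ℚ 6 * (N + 1ℚ + 1ℚ) + x) * (ℕ→ℚ 6 * N - x) ≡
      (ℕ→ℚ 6 * N + ℕ→ℚ 6) * (ℕ→ℚ 6 * N + ℕ→ℚ 6) - (x + ℕ→ℚ 6) * (x + ℕ→ℚ 6)
    lem = solve-∀ ℚ-ring

  term-x² : ∀ n → term (x * x) n ≡ x * Q (ℕ→ℚ n) * u n
  term-x² zero = sym (trans (cong (_* u 0) (lem x)) (inv-inverseʳ d₀≢0))
    where
    lem : ∀ x → x * ((ℕ→ℚ 2 * 0ℚ - ℕ→ℚ 5 - x) * (ℕ→ℚ 2 * 0ℚ - ℕ→ℚ 3 - x) * (ℕ→ℚ 2 * 0ℚ - 1ℚ - x) * (ℕ→ℚ 6 * 0ℚ + ℕ→ℚ 6 + x)) ≡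
      (x + ℕ→ℚ 6) * ((ℕ→ℚ 2 * 0ℚ + 1ℚ + x) * (ℕ→ℚ 2 * 0ℚ + ℕ→ℚ 3 + x) * (ℕ→ℚ 2 * 0ℚ + ℕ→ℚ 5 + x) * (ℕ→ℚ 6 * 0ℚ - x))
    lem = solve-∀ ℚ-ring
  term-x² (suc n) = begin
    term (x * x) n * (coef n * ((oddSq n - x * x) * inv (sixSq n - x * x)))
      ≡⟨ cong (_* (coef n * ((oddSq n - x * x) * inv (sixSq n - x * x)))) (term-x² n) ⟩
    x * Q N * u n * (coef n * ((oddSq n - x * x) * inv (sixSq n - x * x)))
      ≡⟨ lem₁ x (Q N) (u n) (coef n) (oddSq n - x * x) (inv (sixSq n - x * x)) ⟩
    x * u n * coef n * (Q N * (oddSq n - x * x) * inv (sixSq n - x * x))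
      ≡⟨ cong (x * u n * coef n *_) (*-inv-cross (Q N * (oddSq n - x * x)) (Q (N + 1ℚ) * numer N) (sixSq-x²≢0 n) (denom≢0 n) (lem₃ N x)) ⟩
    x * u n * coef n * (Q (N + 1ℚ) * numer N * inv (denom N))
      ≡⟨ lem₂ x (Q (N + 1ℚ)) (u n) (coef n) (numer N) (inv (denom N)) ⟩
    x * Q (N + 1ℚ) * u (suc n)
      ≡⟨ cong (λ M → x * Q M * u (suc n)) (suc≡ n) ⟩
    x * Q (ℕ→ℚ (suc n)) * u (suc n) ∎
    where
    N = ℕ→ℚ n
    lem₁ : ∀ x q u c a i → x * q * u * (c * (a * i)) ≡ x * u * c * (q * a * i)
    lem₁ = solve-∀ ℚ-ring
    lem₂ : ∀ x q u c a i → x * u * c * (q * a * i) ≡ x * q * (u * (c * (a * i)))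
    lem₂ = solve-∀ ℚ-ring
    lem₃ : ∀ N x →
      (ℕ→ℚ 2 * N - ℕ→ℚ 5 - x) * (ℕ→ℚ 2 * N - ℕ→ℚ 3 - x) * (ℕ→ℚ 2 * N - 1ℚ - x) * (ℕ→ℚ 6 * N + ℕ→ℚ 6 + x)
        * ((ℕ→ℚ 2 * N + 1ℚ) * (ℕ→ℚ 2 * N + 1ℚ) - x * x)
        * ((ℕ→ℚ 6 * (N + 1ℚ + 1ℚ) + x) * (ℕ→ℚ 6 * (N + 1ℚ) - x)) ≡
      (ℕ→ℚ 2 * (N + 1ℚ) - ℕ→ℚ 5 - x) * (ℕ→ℚ 2 * (N + 1ℚ) - ℕ→ℚ 3 - x) * (ℕ→ℚ 2 * (N + 1ℚ) - 1ℚ - x) * (ℕ→ℚ 6 * (N + 1ℚ) + ℕ→ℚ 6 + x)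
        * ((ℕ→ℚ 2 * N - ℕ→ℚ 5 - x) * (ℕ→ℚ 2 * N + 1ℚ + x))
        * ((ℕ→ℚ 6 * N + ℕ→ℚ 6) * (ℕ→ℚ 6 * N + ℕ→ℚ 6) - x * x)
    lem₃ = solve-∀ ℚ-ring

  term-[x+6]² : ∀ n → term ((x + ℕ→ℚ 6) * (x + ℕ→ℚ 6)) n ≡ (x + ℕ→ℚ 6) * P (ℕ→ℚ n) * u n
  term-[x+6]² zero = sym (inv-inverseʳ d₀≢0)
  term-[x+6]² (suc n) = begin
    term (z * z) n * (coef n * ((oddSq n - z * z) * inv (sixSq n - z * z)))
      ≡⟨ cong (_* (coef n * ((oddSq n - z * z) * inv (sixSq n - z * z)))) (term-[x+6]² n) ⟩
    z * P N * u n * (coef n * ((oddSq n - z * z) * inv (sixSq n - z * z)))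
      ≡⟨ lem₁ z (P N) (u n) (coef n) (oddSq n - z * z) (inv (sixSq n - z * z)) ⟩
    z * u n * coef n * (P N * (oddSq n - z * z) * inv (sixSq n - z * z))
      ≡⟨ cong (z * u n * coef n *_) (*-inv-cross (P N * (oddSq n - z * z)) (P (N + 1ℚ) * numer N) (sixSq-[x+6]²≢0 n) (denom≢0 n) (lem₃ N x)) ⟩
    z * u n * coef n * (P (N + 1ℚ) * numer N * inv (denom N))
      ≡⟨ lem₂ z (P (N + 1ℚ)) (u n) (coef n) (numer N) (inv (denom N)) ⟩
    z * P (N + 1ℚ) * u (suc n)
      ≡⟨ cong (λ M → z * P M * u (suc n)) (suc≡ n) ⟩
    z * P (ℕ→ℚ (suc n)) * u (suc n) ∎
    where
    N = ℕ→ℚ n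
    z = x + ℕ→ℚ 6
    lem₁ : ∀ x q u c a i → x * q * u * (c * (a * i)) ≡ x * u * c * (q * a * i)
    lem₁ = solve-∀ ℚ-ring
    lem₂ : ∀ x q u c a i → x * u * c * (q * a * i) ≡ x * q * (u * (c * (a * i)))
    lem₂ = solve-∀ ℚ-ring
    lem₃ : ∀ N x →
      (ℕ→ℚ 2 * N + 1ℚ + x) * (ℕ→ℚ 2 * N + ℕ→ℚ 3 + x) * (ℕ→ℚ 2 * N + ℕ→ℚ 5 + x) * (ℕ→ℚ 6 * N - x)
        * ((ℕ→ℚ 2 * N + 1ℚ) * (ℕ→ℚ 2 * N + 1ℚ) - (x + ℕ→ℚ 6) * (x + ℕ→ℚ 6))
        * ((ℕ→ℚ 6 * (N + 1ℚ + 1ℚ) + x) * (ℕ→ℚ 6 * (N + 1ℚ) - x)) ≡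
      (ℕ→ℚ 2 * (N + 1ℚ) + 1ℚ + x) * (ℕ→ℚ 2 * (N + 1ℚ) + ℕ→ℚ 3 + x) * (ℕ→ℚ 2 * (N + 1ℚ) + ℕ→ℚ 5 + x) * (ℕ→ℚ 6 * (N + 1ℚ) - x)
        * ((ℕ→ℚ 2 * N - ℕ→ℚ 5 - x) * (ℕ→ℚ 2 * N + 1ℚ + x))
        * ((ℕ→ℚ 6 * N + ℕ→ℚ 6) * (ℕ→ℚ 6 * N + ℕ→ℚ 6) - (x + ℕ→ℚ 6) * (x + ℕ→ℚ 6))
    lem₃ = solve-∀ ℚ-ring

  -- The factors N(2N-1) and (6N-x)(6N+6+x) are, up to the constant 8, the denominators of `coef`
  -- and of the ratio of `u` at N-1, so they cancel in `certificate (suc n)`. The factor x+3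
  -- reflects that `P - Q` changes sign under x ↦ -6 - x.
  certificate : ℕ → ℚ
  certificate n = - (ℕ→ℚ 16 * (x + ℕ→ℚ 3) * (ℕ→ℚ n * (ℕ→ℚ 2 * ℕ→ℚ n - 1ℚ))
    * ((ℕ→ℚ 6 * ℕ→ℚ n - x) * (ℕ→ℚ 6 * ℕ→ℚ n + ℕ→ℚ 6 + x)) * u n)

  certificate-suc : ∀ n → certificate (suc n) ≡
    certificate n + (ℕ→ℚ 8 * ℕ→ℚ n + 1ℚ) * ((P (ℕ→ℚ n) - Q (ℕ→ℚ n)) * u n)
  certificate-suc n = begin
    certificate (suc n)
      ≡⟨ cong (λ M → - (ℕ→ℚ 16 * (x + ℕ→ℚ 3) * (M * (ℕ→ℚ 2 * M - 1ℚ))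
           * ((ℕ→ℚ 6 * M - x) * (ℕ→ℚ 6 * M + ℕ→ℚ 6 + x)) * u (suc n))) (ℕ→ℚ-suc n) ⟩
    - (ℕ→ℚ 16 * (x + ℕ→ℚ 3) * ((N + 1ℚ) * (ℕ→ℚ 2 * (N + 1ℚ) - 1ℚ))
      * ((ℕ→ℚ 6 * (N + 1ℚ) - x) * (ℕ→ℚ 6 * (N + 1ℚ) + ℕ→ℚ 6 + x)) * u (suc n))
      ≡⟨ lem₁ N x (u n) (inv C) (numer N) (inv (denom N)) ⟩
    - (ℕ→ℚ 2 * (x + ℕ→ℚ 3) * ((ℕ→ℚ 4 * N + 1ℚ) * (ℕ→ℚ 4 * N + ℕ→ℚ 3)) * numer N * u n * (C * inv C) * (denom N * inv (denom N)))
      ≡⟨ cong₂ (λ v w → - (ℕ→ℚ 2 * (x + ℕ→ℚ 3) * ((ℕ→ℚ 4 * N + 1ℚ) * (ℕ→ℚ 4 * N + ℕ→ℚ 3)) * numer N * u n * v * w))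
           (inv-inverseʳ (coefDenominator≢0 n)) (inv-inverseʳ (denom≢0 n)) ⟩
    - (ℕ→ℚ 2 * (x + ℕ→ℚ 3) * ((ℕ→ℚ 4 * N + 1ℚ) * (ℕ→ℚ 4 * N + ℕ→ℚ 3)) * numer N * u n * 1ℚ * 1ℚ)
      ≡⟨ lem₂ N x (u n) ⟩
    certificate n + (ℕ→ℚ 8 * N + 1ℚ) * ((P N - Q N) * u n) ∎
    where
    N = ℕ→ℚ n
    C = ℕ→ℚ 8 * ((ℕ→ℚ 2 * N + 1ℚ) * (N + 1ℚ))
    lem₁ : ∀ N x u c a i →
      - (ℕ→ℚ 16 * (x + ℕ→ℚ 3) * ((N + 1ℚ) * (ℕ→ℚ 2 * (N + 1ℚ) - 1ℚ))
        * ((ℕ→ℚ 6 * (N + 1ℚ) - x) * (ℕ→ℚ 6 * (N + 1ℚ) + ℕ→ℚ 6 + x))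
        * (u * ((ℕ→ℚ 4 * N + 1ℚ) * (ℕ→ℚ 4 * N + ℕ→ℚ 3) * c * (a * i)))) ≡
      - (ℕ→ℚ 2 * (x + ℕ→ℚ 3) * ((ℕ→ℚ 4 * N + 1ℚ) * (ℕ→ℚ 4 * N + ℕ→ℚ 3)) * a * u
        * (ℕ→ℚ 8 * ((ℕ→ℚ 2 * N + 1ℚ) * (N + 1ℚ)) * c)
        * ((ℕ→ℚ 6 * (N + 1ℚ + 1ℚ) + x) * (ℕ→ℚ 6 * (N + 1ℚ) - x) * i))
    lem₁ = solve-∀ ℚ-ring
    lem₂ : ∀ N x u →
      - (ℕ→ℚ 2 * (x + ℕ→ℚ 3) * ((ℕ→ℚ 4 * N + 1ℚ) * (ℕ→ℚ 4 * N + ℕ→ℚ 3))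
        * ((ℕ→ℚ 2 * N - ℕ→ℚ 5 - x) * (ℕ→ℚ 2 * N + 1ℚ + x)) * u * 1ℚ * 1ℚ) ≡
      - (ℕ→ℚ 16 * (x + ℕ→ℚ 3) * (N * (ℕ→ℚ 2 * N - 1ℚ)) * ((ℕ→ℚ 6 * N - x) * (ℕ→ℚ 6 * N + ℕ→ℚ 6 + x)) * u)
      + (ℕ→ℚ 8 * N + 1ℚ) *
        (((ℕ→ℚ 2 * N + 1ℚ + x) * (ℕ→ℚ 2 * N + ℕ→ℚ 3 + x) * (ℕ→ℚ 2 * N + ℕ→ℚ 5 + x) * (ℕ→ℚ 6 * N - x)
        - (ℕ→ℚ 2 * N - ℕ→ℚ 5 - x) * (ℕ→ℚ 2 * N - ℕ→ℚ 3 - x) * (ℕ→ℚ 2 * N - 1ℚ - x) * (ℕ→ℚ 6 * N + ℕ→ℚ 6 + x)) * u)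
    lem₂ = solve-∀ ℚ-ring

  telescope : ∀ M → x * series ((x + ℕ→ℚ 6) * (x + ℕ→ℚ 6)) M ≡
    (x + ℕ→ℚ 6) * series (x * x) M + x * (x + ℕ→ℚ 6) * certificate M
  telescope zero = lem x (u 0)
    where
    lem : ∀ x u → x * 0ℚ ≡ (x + ℕ→ℚ 6) * 0ℚ + x * (x + ℕ→ℚ 6) *
      - (ℕ→ℚ 16 * (x + ℕ→ℚ 3) * (0ℚ * (ℕ→ℚ 2 * 0ℚ - 1ℚ)) * ((ℕ→ℚ 6 * 0ℚ - x) * (ℕ→ℚ 6 * 0ℚ + ℕ→ℚ 6 + x)) * u)
    lem = solve-∀ ℚ-ring
  telescope (suc M) = begin
    x * (series (z * z) M + w * term (z * z) M)
      ≡⟨ cong (λ v → x * (series (z * z) M + w * v)) (term-[x+6]² M) ⟩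
    x * (series (z * z) M + w * (z * P N * u M))
      ≡⟨ ℚₚ.*-distribˡ-+ x _ _ ⟩
    x * series (z * z) M + x * (w * (z * P N * u M))
      ≡⟨ cong (_+ x * (w * (z * P N * u M))) (telescope M) ⟩
    z * series (x * x) M + x * z * certificate M + x * (w * (z * P N * u M))
      ≡⟨ lem x z w (P N) (Q N) (u M) (series (x * x) M) (certificate M) ⟩
    z * (series (x * x) M + w * (x * Q N * u M)) + x * z * (certificate M + w * ((P N - Q N) * u M))
      ≡⟨ sym (cong₂ (λ v v′ → z * (series (x * x) M + w * v) + x * z * v′) (term-x² M) (certificate-suc M)) ⟩
    z * (series (x * x) M + w * term (x * x) M) + x * z * certificate (suc M) ∎
    where
    N = ℕ→ℚ M
    z = x + ℕ→ℚ 6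
    w = ℕ→ℚ 8 * N + 1ℚ
    lem : ∀ x z w p q u s c → z * s + x * z * c + x * (w * (z * p * u)) ≡
      z * (s + w * (x * q * u)) + x * z * (c + w * ((p - q) * u))
    lem = solve-∀ ℚ-ring

-- Closed form of the sum at the odd squares.

ℕ→ℚ-injective : ∀ {m n} → ℕ→ℚ m ≡ ℕ→ℚ n → m ≡ n
ℕ→ℚ-injective {m} {n} eq = ℤₚ.+-injective (ι-injective {+ m} {+ n} eq)

odd : ℕ → ℚ
odd l = ℕ→ℚ 2 * ℕ→ℚ l + 1ℚ

odd≡ : ∀ l → ℕ→ℚ (suc (2 ℕ.* l)) ≡ odd l
odd≡ l = trans (ℕ→ℚ-suc (2 ℕ.* l)) (cong (_+ 1ℚ) (ℕ→ℚ-* 2 l))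

odd-+3 : ∀ l → odd (3 ℕ.+ l) ≡ odd l + ℕ→ℚ 6
odd-+3 l = trans (cong (λ L → ℕ→ℚ 2 * L + 1ℚ) (ℕ→ℚ-+ 3 l)) (lem (ℕ→ℚ l))
  where
  lem : ∀ L → ℕ→ℚ 2 * (ℕ→ℚ 3 + L) + 1ℚ ≡ ℕ→ℚ 2 * L + 1ℚ + ℕ→ℚ 6
  lem = solve-∀ ℚ-ring

odd+i≢0 : ∀ l i → odd l + ℕ→ℚ i ≢ 0ℚ
odd+i≢0 l i eq = ℕ→ℚ-≢0 (2 ℕ.* l ℕ.+ i)
  (trans (ℕ→ℚ-+ (suc (2 ℕ.* l)) i) (trans (cong (_+ ℕ→ℚ i) (odd≡ l)) eq))

-≡0⇒≡ : ∀ {a b} → a - b ≡ 0ℚ → a ≡ b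
-≡0⇒≡ {a} {b} eq = trans (lem a b) (trans (cong (_+ b) eq) (ℚₚ.+-identityˡ b))
  where
  lem : ∀ a b → a ≡ a - b + b
  lem = solve-∀ ℚ-ring

6n-odd≢0 : ∀ l n → ℕ→ℚ 6 * ℕ→ℚ n - odd l ≢ 0ℚ
6n-odd≢0 l n eq = ℕₚ.even≢odd (3 ℕ.* n) l (trans (sym (ℕₚ.*-assoc 2 3 n)) (ℕ→ℚ-injective
  (trans (ℕ→ℚ-* 6 n) (trans (-≡0⇒≡ eq) (sym (odd≡ l))))))

-- Indexed by `l`, not by x = 2l+1: the quadratic character modulo 3 at x. Period 6 in x becomes
-- period 3 in `l`.
χ : ℕ → ℤ
χ 0 = + 1
χ 1 = + 0
χ 2 = -[1+ 0 ]
χ (suc (suc (suc l))) = χ l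

absorb : ∀ {a} b → a ≡ 0ℚ → a * b ≡ 0ℚ
absorb b refl = ℚₚ.*-zeroˡ b

absorbʳ : ∀ a {b} → b ≡ 0ℚ → a * b ≡ 0ℚ
absorbʳ a refl = ℚₚ.*-zeroʳ a

term-oddSq≡0 : ∀ l r → term (oddSq l) (suc l ℕ.+ r) ≡ 0ℚ
term-oddSq≡0 l zero = begin
  term (oddSq l) (suc l ℕ.+ 0)   ≡⟨ cong (term (oddSq l)) (ℕₚ.+-identityʳ (suc l)) ⟩
  term (oddSq l) l * (coef l * ((oddSq l - oddSq l) * inv (sixSq l - oddSq l)))
    ≡⟨ cong (λ v → term (oddSq l) l * (coef l * (v * inv (sixSq l - oddSq l)))) (ℚₚ.+-inverseʳ (oddSq l)) ⟩
  term (oddSq l) l * (coef l * (0ℚ * inv (sixSq l - oddSq l)))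
    ≡⟨ lem (term (oddSq l) l) (coef l) (inv (sixSq l - oddSq l)) ⟩
  0ℚ ∎
  where
  lem : ∀ t c i → t * (c * (0ℚ * i)) ≡ 0ℚ
  lem = solve-∀ ℚ-ring
term-oddSq≡0 l (suc r) = trans (cong (term (oddSq l)) (ℕₚ.+-suc (suc l) r)) (absorb _ (term-oddSq≡0 l r))

series-truncate : ∀ l r → series (oddSq l) (suc l ℕ.+ r) ≡ series (oddSq l) (suc l)
series-truncate l r = sum-vanish (suc l) r _ (λ i →
  absorbʳ (ℕ→ℚ 8 * ℕ→ℚ (suc l ℕ.+ i) + 1ℚ) (term-oddSq≡0 l i))

series-oddSq-base : ∀ l {M} → l < M → series (oddSq l) (suc l) ≡ odd l * ι (χ l) →
  series (oddSq l) M ≡ odd l * ι (χ l)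
series-oddSq-base l {M} l<M eq = trans (cong (series (oddSq l)) (sym (ℕₚ.m+[n∸m]≡n l<M)))
  (trans (series-truncate l (M ∸ suc l)) eq)

module _ (l : ℕ) where
  open Shift (odd l) (odd+i≢0 l) (6n-odd≢0 l)

  -- At x = 2l+1 the factor 2N-5-x of `numer` is zero for N = l+3, which kills `u` from the next
  -- index on.
  u≡0 : ∀ r → u (4 ℕ.+ l ℕ.+ r) ≡ 0ℚ
  u≡0 zero = begin
    u (4 ℕ.+ l ℕ.+ 0)  ≡⟨ cong u (ℕₚ.+-identityʳ (4 ℕ.+ l)) ⟩
    u n * (coef n * (numer (ℕ→ℚ n) * inv (denom (ℕ→ℚ n))))
      ≡⟨ cong (λ v → u n * (coef n * (v * inv (denom (ℕ→ℚ n))))) numer≡0 ⟩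
    u n * (coef n * (0ℚ * inv (denom (ℕ→ℚ n))))
      ≡⟨ lem (u n) (coef n) (inv (denom (ℕ→ℚ n))) ⟩
    0ℚ ∎
    where
    n = 3 ℕ.+ l
    lem : ∀ t c i → t * (c * (0ℚ * i)) ≡ 0ℚ
    lem = solve-∀ ℚ-ring
    lem₂ : ∀ L → (ℕ→ℚ 2 * (ℕ→ℚ 3 + L) - ℕ→ℚ 5 - (ℕ→ℚ 2 * L + 1ℚ)) * (ℕ→ℚ 2 * (ℕ→ℚ 3 + L) + 1ℚ + (ℕ→ℚ 2 * L + 1ℚ)) ≡ 0ℚ
    lem₂ = solve-∀ ℚ-ring
    numer≡0 : numer (ℕ→ℚ n) ≡ 0ℚ
    numer≡0 = trans (cong numer (ℕ→ℚ-+ 3 l)) (lem₂ (ℕ→ℚ l))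
  u≡0 (suc r) = trans (cong u (ℕₚ.+-suc (4 ℕ.+ l) r)) (absorb _ (u≡0 r))

  -- Beyond index l+3 the boundary term `certificate M` is zero, so `telescope` says that S(x²)/x
  -- does not change under x → x + 6.
  series-oddSq-step : ∀ {M} → 3 ℕ.+ l < M → series (oddSq l) M ≡ odd l * ι (χ l) →
    series (oddSq (3 ℕ.+ l)) M ≡ odd (3 ℕ.+ l) * ι (χ l)
  series-oddSq-step {M} l<M ih = *-cancelʳ x≢0 (begin
    series (oddSq (3 ℕ.+ l)) M * x
      ≡⟨ cong (λ v → series (v * v) M * x) (odd-+3 l) ⟩
    series (z * z) M * x          ≡⟨ ℚₚ.*-comm _ x ⟩
    x * series (z * z) M          ≡⟨ telescope M ⟩
    z * series (x * x) M + x * z * certificate M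
      ≡⟨ cong₂ (λ v w → z * v + x * z * w) ih certificate≡0 ⟩
    z * (x * ι (χ l)) + x * z * 0ℚ  ≡⟨ lem x z (ι (χ l)) ⟩
    z * ι (χ l) * x               ≡⟨ cong (λ v → v * ι (χ l) * x) (sym (odd-+3 l)) ⟩
    odd (3 ℕ.+ l) * ι (χ l) * x   ∎)
    where
    x = odd l
    z = x + ℕ→ℚ 6
    lem : ∀ x z c → z * (x * c) + x * z * 0ℚ ≡ z * c * x
    lem = solve-∀ ℚ-ring
    certificate≡0 : certificate M ≡ 0ℚ
    certificate≡0 = cong -_ (absorbʳ c (trans (cong u (sym (ℕₚ.m+[n∸m]≡n l<M))) (u≡0 (M ∸ (4 ℕ.+ l)))))
      where c = ℕ→ℚ 16 * (x + ℕ→ℚ 3) * (ℕ→ℚ M * (ℕ→ℚ 2 * ℕ→ℚ M - 1ℚ)) * ((ℕ→ℚ 6 * ℕ→ℚ M - x) * (ℕ→ℚ 6 * ℕ→ℚ M + ℕ→ℚ 6 + x))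

-- Induction in steps of three, one step being x → x + 6. The base cases x = 1, 3, 5 have at most
-- three nonzero terms and evaluate to 1, 0, -5.
series-oddSq : ∀ l {M} → l < M → series (oddSq l) M ≡ odd l * ι (χ l)
series-oddSq 0 l<M = series-oddSq-base 0 l<M refl
series-oddSq 1 l<M = series-oddSq-base 1 l<M refl
series-oddSq 2 l<M = series-oddSq-base 2 l<M refl
series-oddSq (suc (suc (suc l))) l<M =
  series-oddSq-step l l<M (series-oddSq l (ℕₚ.<-trans (ℕₚ.m<n+m l (ℕ.s≤s ℕ.z≤n)) l<M))

-- Interpolation at the odd squares

1/n*n≡1 : ∀ n .{{_ : ℕ.NonZero n}} → (+ 1 / n) * ℕ→ℚ n ≡ 1ℚ
1/n*n≡1 (suc m) = ℚₚ.toℚᵘ-injective (≃-trans (ℚₚ.toℚᵘ-homo-* (+ 1 / suc m) (ι (+ suc m)))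
  (≃-trans (ℚᵘₚ.*-cong (ℚₚ.toℚᵘ-fromℚᵘ (ℚᵘ.mkℚᵘ (+ 1) m)) (ι-toℚᵘ (+ suc m)))
    (ℚᵘ.*≡* (cong +_ (ℕ-lem m)))))
  where
  ℕ-lem : ∀ m → 1 ℕ.* suc m ℕ.* 1 ≡ 1 ℕ.* (suc m ℕ.* 1)
  ℕ-lem m = ℕₚ.*-assoc 1 (suc m) 1

invFact-suc : ∀ k → invFact (suc k) ≡ invFact k * inv (ℕ→ℚ k + 1ℚ)
invFact-suc k = *-cancelʳ (*-≢0 fact≢0 (k+1≢0 k)) (begin
  invFact (suc k) * (ℕ→ℚ (k !) * K)    ≡⟨ cong (invFact (suc k) *_) (sym suc!) ⟩
  invFact (suc k) * ℕ→ℚ (suc k !)      ≡⟨ 1/n*n≡1 (suc k !) {{suc k !≢0}} ⟩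
  1ℚ * 1ℚ                              ≡⟨ sym (cong₂ _*_ (1/n*n≡1 (k !) {{k !≢0}}) (inv-inverseʳ (k+1≢0 k))) ⟩
  invFact k * ℕ→ℚ (k !) * (K * inv K)  ≡⟨ lem (invFact k) (ℕ→ℚ (k !)) K (inv K) ⟩
  invFact k * inv K * (ℕ→ℚ (k !) * K)  ∎)
  where
  open ℕₚ using (_!≢0)
  K = ℕ→ℚ k + 1ℚ
  lem : ∀ a b c d → a * b * (c * d) ≡ a * d * (b * c)
  lem = solve-∀ ℚ-ring
  suc! : ℕ→ℚ (suc k !) ≡ ℕ→ℚ (k !) * K
  suc! = trans (ℕ→ℚ-* (suc k) (k !)) (trans (ℚₚ.*-comm (ℕ→ℚ (suc k)) (ℕ→ℚ (k !))) (cong (ℕ→ℚ (k !) *_) (ℕ→ℚ-suc k)))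
  fact≢0 : ℕ→ℚ (k !) ≢ 0ℚ
  fact≢0 = ι-≢0 {+ (k !)} (λ eq → ℕ.≢-nonZero⁻¹ (k !) {{k !≢0}} (ℤₚ.+-injective eq))

sixSq≢0 : ∀ k → sixSq k - 0ℚ ≢ 0ℚ
sixSq≢0 k eq = *-≢0 6k+6≢0 6k+6≢0 (-≡0⇒≡ eq)
  where
  lem : ∀ K → ℕ→ℚ 6 * (K + 1ℚ) ≡ ℕ→ℚ 6 * K + ℕ→ℚ 6
  lem = solve-∀ ℚ-ring
  6k+6≢0 : ℕ→ℚ 6 * ℕ→ℚ k + ℕ→ℚ 6 ≢ 0ℚ
  6k+6≢0 eq = *-≢0 (ℕ→ℚ-≢0 5) (k+1≢0 k) (trans (lem (ℕ→ℚ k)) eq)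

summand : ℕ → ℚ
summand k = poch (+ 1 / 4) k * poch (+ 1 / 2) k * poch (+ 3 / 4) k * ((invFact k ^ℚ 3) * ((+ 1 / 9) ^ℚ k))

summand≡term : ∀ k → summand k ≡ term 0ℚ k
summand≡term zero = refl
summand≡term (suc k) = begin
  summand (suc k)
    ≡⟨ cong (λ f → poch (+ 1 / 4) (suc k) * poch (+ 1 / 2) (suc k) * poch (+ 3 / 4) (suc k) * ((f ^ℚ 3) * ((+ 1 / 9) ^ℚ suc k))) (invFact-suc k) ⟩
  p * (+ 1 / 4 + K) * (q * (+ 1 / 2 + K)) * (r * (+ 3 / 4 + K))
    * (f * c * (f * c * (f * c * 1ℚ)) * (+ 1 / 9 * n))
    ≡⟨ lem₁ p q r f n K c ⟩
  p * q * r * (f * (f * (f * 1ℚ)) * n) * ((+ 1 / 4 + K) * (+ 1 / 2 + K) * (+ 3 / 4 + K) * (+ 1 / 9) * (c * c * c))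
    ≡⟨ cong₂ _*_ (summand≡term k) ratio ⟩
  term 0ℚ (suc k) ∎
  where
  p = poch (+ 1 / 4) k
  q = poch (+ 1 / 2) k
  r = poch (+ 3 / 4) k
  f = invFact k
  n = (+ 1 / 9) ^ℚ k
  K = ℕ→ℚ k
  c = inv (K + 1ℚ)
  D = ℕ→ℚ 8 * ((ℕ→ℚ 2 * K + 1ℚ) * (K + 1ℚ))
  lem₁ : ∀ p q r f n K c →
    p * (+ 1 / 4 + K) * (q * (+ 1 / 2 + K)) * (r * (+ 3 / 4 + K))
      * (f * c * (f * c * (f * c * 1ℚ)) * (+ 1 / 9 * n)) ≡
    p * q * r * (f * (f * (f * 1ℚ)) * n) * ((+ 1 / 4 + K) * (+ 1 / 2 + K) * (+ 3 / 4 + K) * (+ 1 / 9) * (c * c * c))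
  lem₁ = solve-∀ ℚ-ring
  lem₂ : ∀ K c →
    (+ 1 / 4 + K) * (+ 1 / 2 + K) * (+ 3 / 4 + K) * (+ 1 / 9) * (c * c * c)
      * (ℕ→ℚ 8 * ((ℕ→ℚ 2 * K + 1ℚ) * (K + 1ℚ)) * ((ℕ→ℚ 6 * K + ℕ→ℚ 6) * (ℕ→ℚ 6 * K + ℕ→ℚ 6) - 0ℚ)) ≡
    (ℕ→ℚ 4 * K + 1ℚ) * (ℕ→ℚ 4 * K + ℕ→ℚ 3) * ((ℕ→ℚ 2 * K + 1ℚ) * (ℕ→ℚ 2 * K + 1ℚ) - 0ℚ)
      * (((K + 1ℚ) * c) * ((K + 1ℚ) * c) * ((K + 1ℚ) * c))
  lem₂ = solve-∀ ℚ-ring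
  lem₃ : ∀ a b i d j e → a * b * (d * i) * (e * j) ≡ a * i * (b * j) * (d * e)
  lem₃ = solve-∀ ℚ-ring
  lem₄ : ∀ a → a * (1ℚ * 1ℚ * 1ℚ) ≡ a * 1ℚ * 1ℚ
  lem₄ = solve-∀ ℚ-ring
  u = (ℕ→ℚ 4 * K + 1ℚ) * (ℕ→ℚ 4 * K + ℕ→ℚ 3)
  v = oddSq k - 0ℚ
  s = sixSq k - 0ℚ
  -- The constants agree because 4·2·4·9 = 8·36.
  ratio : (+ 1 / 4 + K) * (+ 1 / 2 + K) * (+ 3 / 4 + K) * (+ 1 / 9) * (c * c * c) ≡ coef k * (v * inv s)
  ratio = *-cancelʳ (*-≢0 (coefDenominator≢0 k) (sixSq≢0 k)) (begin
    (+ 1 / 4 + K) * (+ 1 / 2 + K) * (+ 3 / 4 + K) * (+ 1 / 9) * (c * c * c) * (D * s)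
      ≡⟨ lem₂ K c ⟩
    u * v * (((K + 1ℚ) * c) * ((K + 1ℚ) * c) * ((K + 1ℚ) * c))
      ≡⟨ cong (λ e → u * v * (e * e * e)) (inv-inverseʳ (k+1≢0 k)) ⟩
    u * v * (1ℚ * 1ℚ * 1ℚ)  ≡⟨ lem₄ (u * v) ⟩
    u * v * 1ℚ * 1ℚ
      ≡⟨ sym (cong₂ (λ d e → u * v * d * e) (inv-inverseʳ (coefDenominator≢0 k)) (inv-inverseʳ (sixSq≢0 k))) ⟩
    u * v * (D * inv D) * (s * inv s)  ≡⟨ lem₃ u v (inv D) D (inv s) s ⟩
    coef k * (v * inv s) * (D * s) ∎)

sum≡series : ∀ M → sumℚ M (λ k → summand k * ℕ→ℚ (8 ℕ.* k ℕ.+ 1)) ≡ series 0ℚ M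
sum≡series M = sum-cong M (λ {k} _ → trans (ℚₚ.*-comm (summand k) _)
  (cong₂ _*_ (trans (ℕ→ℚ-+ (8 ℕ.* k) 1) (cong (_+ 1ℚ) (ℕ→ℚ-* 8 k))) (summand≡term k)))

oddSq-oddSq : ∀ i j → oddSq i - oddSq j ≡ ℕ→ℚ 4 * ((ℕ→ℚ i - ℕ→ℚ j) * (ℕ→ℚ i + ℕ→ℚ j + 1ℚ))
oddSq-oddSq i j = lem (ℕ→ℚ i) (ℕ→ℚ j)
  where
  lem : ∀ I J → (ℕ→ℚ 2 * I + 1ℚ) * (ℕ→ℚ 2 * I + 1ℚ) - (ℕ→ℚ 2 * J + 1ℚ) * (ℕ→ℚ 2 * J + 1ℚ) ≡
    ℕ→ℚ 4 * ((I - J) * (I + J + 1ℚ))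
  lem = solve-∀ ℚ-ring

oddSq-distinct : ∀ {i j} → i ≢ j → oddSq i - oddSq j ≢ 0ℚ
oddSq-distinct {i} {j} i≢j eq = *-≢0 (ℕ→ℚ-≢0 3) (*-≢0
  (λ e → i≢j (ℕ→ℚ-injective (-≡0⇒≡ e)))
  (λ e → k+1≢0 (i ℕ.+ j) (trans (cong (_+ 1ℚ) (ℕ→ℚ-+ i j)) e)))
  (trans (sym (oddSq-oddSq i j)) eq)

sixSq-oddSq≢0 : ∀ i l → sixSq i - oddSq l ≢ 0ℚ
sixSq-oddSq≢0 i l = Shift.sixSq-x²≢0 (odd l) (odd+i≢0 l) (6n-odd≢0 l) i

oddSq≢0 : ∀ j → oddSq j - 0ℚ ≢ 0ℚ
oddSq≢0 j eq = *-≢0 (2k+1≢0 j) (2k+1≢0 j) (-≡0⇒≡ eq)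

module _ (k : ℕ) where

  -- The roots in X of t_k(X) ∏ (`sixSq i` - X): the first `k` factors of the product are cancelled
  -- by the denominator of t_k and replaced by its numerator.
  splice : ℕ → ℚ
  splice i = if i ℕ.<ᵇ k then oddSq i else sixSq i

  splice-< : ∀ {i} → i < k → splice i ≡ oddSq i
  splice-< {i} i<k with i ℕ.<ᵇ k in eq
  ... | true  = refl
  ... | false = ⊥-elim (subst T eq (ℕₚ.<⇒<ᵇ i<k))

  splice-≥ : ∀ r → splice (k ℕ.+ r) ≡ sixSq (k ℕ.+ r)
  splice-≥ r with k ℕ.+ r ℕ.<ᵇ k in eq
  ... | true  = contradiction (ℕₚ.<ᵇ⇒< (k ℕ.+ r) k (subst T (sym eq) _)) (ℕₚ.m+n≮m k r)
  ... | false = refl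

  module _ (X : ℚ) (six≢ : ∀ i → sixSq i - X ≢ 0ℚ) where

    term-prod : ∀ n → prod n coef * prod n (λ i → oddSq i - X) ≡ term X n * prod n (λ i → sixSq i - X)
    term-prod zero = refl
    term-prod (suc n) = begin
      c * coef n * (o * (oddSq n - X))     ≡⟨ lem₁ c (coef n) o (oddSq n - X) ⟩
      c * o * (coef n * (oddSq n - X))     ≡⟨ cong (_* (coef n * (oddSq n - X))) (term-prod n) ⟩
      term X n * s * (coef n * (oddSq n - X))  ≡⟨ sym (ℚₚ.*-identityʳ _) ⟩
      term X n * s * (coef n * (oddSq n - X)) * 1ℚ
        ≡⟨ cong (term X n * s * (coef n * (oddSq n - X)) *_) (sym (inv-inverseʳ (six≢ n))) ⟩
      term X n * s * (coef n * (oddSq n - X)) * ((sixSq n - X) * inv (sixSq n - X))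
        ≡⟨ lem₂ (term X n) s (coef n) (oddSq n - X) (sixSq n - X) (inv (sixSq n - X)) ⟩
      term X (suc n) * (s * (sixSq n - X)) ∎
      where
      c = prod n coef
      o = prod n (λ i → oddSq i - X)
      s = prod n (λ i → sixSq i - X)
      lem₁ : ∀ a b c d → a * b * (c * d) ≡ a * c * (b * d)
      lem₁ = solve-∀ ℚ-ring
      lem₂ : ∀ t s c o x i → t * s * (c * o) * (x * i) ≡ t * (c * (o * i)) * (s * x)
      lem₂ = solve-∀ ℚ-ring

    splice-prod-+ : ∀ r → prod k coef * prod (k ℕ.+ r) (λ i → splice i - X) ≡
      term X k * prod (k ℕ.+ r) (λ i → sixSq i - X)
    splice-prod-+ zero = subst (λ n → prod k coef * prod n (λ i → splice i - X) ≡ term X k * prod n (λ i → sixSq i - X))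
      (sym (ℕₚ.+-identityʳ k))
      (trans (cong (prod k coef *_) (prod-cong k (λ i<k → cong (_- X) (splice-< i<k)))) (term-prod k))
    splice-prod-+ (suc r) = subst (λ n → prod k coef * prod n (λ i → splice i - X) ≡ term X k * prod n (λ i → sixSq i - X))
      (sym (ℕₚ.+-suc k r))
      (begin
        prod k coef * (prod (k ℕ.+ r) (λ i → splice i - X) * (splice (k ℕ.+ r) - X))
          ≡⟨ sym (ℚₚ.*-assoc (prod k coef) _ _) ⟩
        prod k coef * prod (k ℕ.+ r) (λ i → splice i - X) * (splice (k ℕ.+ r) - X)
          ≡⟨ cong₂ _*_ (splice-prod-+ r) (cong (_- X) (splice-≥ r)) ⟩
        term X k * prod (k ℕ.+ r) (λ i → sixSq i - X) * (sixSq (k ℕ.+ r) - X)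
          ≡⟨ ℚₚ.*-assoc (term X k) _ _ ⟩
        term X k * (prod (k ℕ.+ r) (λ i → sixSq i - X) * (sixSq (k ℕ.+ r) - X)) ∎)

    splice-prod : ∀ {n} → k ≤ n → prod k coef * prod n (λ i → splice i - X) ≡
      term X k * prod n (λ i → sixSq i - X)
    splice-prod {n} k≤n = subst (λ n → prod k coef * prod n (λ i → splice i - X) ≡ term X k * prod n (λ i → sixSq i - X))
      (ℕₚ.m+[n∸m]≡n k≤n) (splice-prod-+ (n ∸ k))

module Interpolation (n : ℕ) where

  nodeProd : ℚ → ℚ
  nodeProd X = prod n (λ i → sixSq i - X) * prod (suc n) (λ j → inv (oddSq j - X))

  -- At `oddSq l` the factor `j = l` of `nodeProd` is `inv 0ℚ = 1ℚ`, so this is the node product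
  -- with its own pole removed.
  weight : ℕ → ℚ
  weight l = nodeProd (oddSq l) * inv (oddSq l - 0ℚ)

  -- Partial fractions with numerator roots `splice k`. At each node `splice-prod` converts
  -- `prod k coef` times the numerator back into `term (oddSq l) k` times the product of the
  -- `sixSq i - oddSq l`. The bound `k ≤ n` keeps the degree below the number of nodes.
  term-interpolation : ∀ {k} → k ≤ n →
    term 0ℚ k * nodeProd 0ℚ ≡ sumℚ (suc n) (λ l → term (oddSq l) k * weight l)
  term-interpolation {k} k≤n = begin
    term 0ℚ k * (S 0ℚ * I 0ℚ)        ≡⟨ sym (ℚₚ.*-assoc (term 0ℚ k) _ _) ⟩
    term 0ℚ k * S 0ℚ * I 0ℚ          ≡⟨ cong (_* I 0ℚ) (sym (splice-prod k 0ℚ sixSq≢0 k≤n)) ⟩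
    prod k coef * A 0ℚ * I 0ℚ        ≡⟨ lem₁ (prod k coef) (A 0ℚ) (I 0ℚ) ⟩
    A 0ℚ * I 0ℚ * prod k coef        ≡⟨ cong (_* prod k coef) (partial-fractions n 0ℚ (λ {j} _ → oddSq≢0 j)) ⟩
    sumℚ (suc n) (λ l → residue n l * inv (oddSq l - 0ℚ)) * prod k coef  ≡⟨ sum-*ʳ (suc n) _ _ ⟩
    sumℚ (suc n) (λ l → residue n l * inv (oddSq l - 0ℚ) * prod k coef)  ≡⟨ sum-cong (suc n) (λ {l} _ → eq l) ⟩
    sumℚ (suc n) (λ l → term (oddSq l) k * weight l) ∎
    where
    open PartialFractions (splice k) oddSq oddSq-distinct
    S I A : ℚ → ℚ
    S X = prod n (λ i → sixSq i - X)
    I X = prod (suc n) (λ j → inv (oddSq j - X))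
    A X = prod n (λ i → splice k i - X)
    lem₁ : ∀ c a i → c * a * i ≡ a * i * c
    lem₁ = solve-∀ ℚ-ring
    lem₂ : ∀ a i v c → a * i * v * c ≡ c * a * (i * v)
    lem₂ = solve-∀ ℚ-ring
    lem₃ : ∀ t s i v → t * s * (i * v) ≡ t * (s * i * v)
    lem₃ = solve-∀ ℚ-ring
    eq : ∀ l → residue n l * inv (oddSq l - 0ℚ) * prod k coef ≡ term (oddSq l) k * weight l
    eq l = trans (lem₂ (A (oddSq l)) (I (oddSq l)) (inv (oddSq l - 0ℚ)) (prod k coef))
      (trans (cong (_* (I (oddSq l) * inv (oddSq l - 0ℚ))) (splice-prod k (oddSq l) (λ i → sixSq-oddSq≢0 i l) k≤n))
        (lem₃ (term (oddSq l) k) (S (oddSq l)) (I (oddSq l)) (inv (oddSq l - 0ℚ))))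

  series-interpolation :
    series 0ℚ (suc n) * nodeProd 0ℚ ≡ sumℚ (suc n) (λ l → series (oddSq l) (suc n) * weight l)
  series-interpolation = begin
    series 0ℚ (suc n) * nodeProd 0ℚ    ≡⟨ sum-*ʳ (suc n) _ _ ⟩
    sumℚ (suc n) (λ k → w k * term 0ℚ k * nodeProd 0ℚ)
      ≡⟨ sum-cong (suc n) (λ {k} k<n → trans (ℚₚ.*-assoc (w k) _ _) (trans (cong (w k *_) (term-interpolation (ℕₚ.≤-pred k<n)))
           (trans (ℚₚ.*-comm (w k) _) (trans (sum-*ʳ (suc n) _ _) (sum-cong (suc n) (λ {l} _ → lem (term (oddSq l) k) (weight l) (w k))))))) ⟩
    sumℚ (suc n) (λ k → sumℚ (suc n) (λ l → w k * term (oddSq l) k * weight l))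
      ≡⟨ sum-comm (suc n) (suc n) (λ k l → w k * term (oddSq l) k * weight l) ⟩
    sumℚ (suc n) (λ l → sumℚ (suc n) (λ k → w k * term (oddSq l) k * weight l))
      ≡⟨ sum-cong (suc n) (λ _ → sym (sum-*ʳ (suc n) _ _)) ⟩
    sumℚ (suc n) (λ l → series (oddSq l) (suc n) * weight l) ∎
    where
    w : ℕ → ℚ
    w k = ℕ→ℚ 8 * ℕ→ℚ k + 1ℚ
    lem : ∀ t v w → t * v * w ≡ w * t * v
    lem = solve-∀ ℚ-ring

-- Localisation at p

update : (ℕ → ℚ) → ℕ → ℚ → ℕ → ℚ
update f l v i with i ℕₚ.≟ l
... | yes _ = v
... | no  _ = f i

update-≡ : ∀ f l v → update f l v l ≡ v
update-≡ f l v with l ℕₚ.≟ l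
... | yes _  = refl
... | no l≢l = contradiction refl l≢l

update-≢ : ∀ f {i l} v → i ≢ l → update f l v i ≡ f i
update-≢ f {i} {l} v i≢l with i ℕₚ.≟ l
... | yes i≡l = contradiction i≡l i≢l
... | no _    = refl

-- Exchanging one factor is stated by cross-multiplication, so `f l` may be zero.
prod-update : ∀ {n} f l v → l < n → prod n (update f l v) * f l ≡ prod n f * v
prod-update {suc n} f l v l<1+n with n ℕₚ.≟ l
... | yes refl = begin
  prod n (update f l v) * v * f l  ≡⟨ cong (λ t → t * v * f l) (prod-cong n (λ i<n → update-≢ f v (ℕₚ.<⇒≢ i<n))) ⟩
  prod n f * v * f l               ≡⟨ lem (prod n f) v (f l) ⟩
  prod n f * f l * v               ∎
  where
  lem : ∀ a b c → a * b * c ≡ a * c * b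
  lem = solve-∀ ℚ-ring
... | no n≢l = begin
  prod n (update f l v) * f n * f l  ≡⟨ lem (prod n (update f l v)) (f n) (f l) ⟩
  prod n (update f l v) * f l * f n  ≡⟨ cong (_* f n) (prod-update f l v (ℕₚ.≤∧≢⇒< (ℕₚ.≤-pred l<1+n) (λ l≡n → n≢l (sym l≡n)))) ⟩
  prod n f * v * f n                 ≡⟨ lem (prod n f) v (f n) ⟩
  prod n f * f n * v                 ∎
  where
  lem : ∀ a b c → a * b * c ≡ a * c * b
  lem = solve-∀ ℚ-ring

module Localisation {p : ℕ} (isPrime : Prime p) where

  euclid : ∀ a b → + p ∣ a ℤ.* b → (+ p ∣ a) ⊎ (+ p ∣ b)
  euclid a b p∣ab = Sum.map ∣ᵤ⇒∣ ∣ᵤ⇒∣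
    (euclidsLemma ℤ.∣ a ∣ ℤ.∣ b ∣ isPrime (subst (p ℕ∣.∣_) (ℤₚ.abs-* a b) (∣⇒∣ᵤ p∣ab)))

  ∤-* : ∀ {a b} → ¬ (+ p ∣ a) → ¬ (+ p ∣ b) → ¬ (+ p ∣ a ℤ.* b)
  ∤-* {a} {b} p∤a p∤b p∣ab = [ p∤a , p∤b ]′ (euclid a b p∣ab)

  p∤1 : ¬ (+ p ∣ + 1)
  p∤1 p∣1 = ℕ.nonTrivial⇒≢1 {{prime⇒nonTrivial isPrime}} (ℕ∣.∣1⇒≡1 (∣⇒∣ᵤ p∣1))

  ∤-small : ∀ {i} → ℤ.∣ i ∣ < p → i ≢ + 0 → ¬ (+ p ∣ i)
  ∤-small {i} i<p i≢0 p∣i = ℕₚ.<⇒≱ i<p (ℕ∣.∣⇒≤ {{ℕ.≢-nonZero (λ e → i≢0 (ℤₚ.∣i∣≡0⇒i≡0 e))}} (∣⇒∣ᵤ p∣i))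

  p∤difference : ∀ {i j} → i < p → j < p → i ≢ j → ¬ (+ p ∣ + i ℤ.- + j)
  p∤difference {i} {j} i<p j<p i≢j = ∤-small
    (subst (λ z → ℤ.∣ z ∣ < p) (sym (ℤₚ.m-n≡m⊖n i j)) (ℕₚ.≤-<-trans (ℤₚ.∣m⊝n∣≤m⊔n i j) (ℕₚ.⊔-lub i<p j<p)))
    (λ e → i≢j (ℤₚ.+-injective (ℤₚ.i-j≡0⇒i≡j (+ i) (+ j) e)))

  -- Membership in ℤ localised at the prime ideal (p). The fraction need not be reduced, so closure
  -- under sums and products involves no gcd.
  record Integral (q : ℚ) : Set where
    constructor integral
    field
      num den   : ℤ
      p∤den     : ¬ (+ p ∣ den)
      q*den≡num : q * ι den ≡ ι num

  ι-integral : ∀ i → Integral (ι i)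
  ι-integral i = integral i (+ 1) p∤1 (ℚₚ.*-identityʳ (ι i))

  +-integral : ∀ {q r} → Integral q → Integral r → Integral (q + r)
  +-integral {q} {r} (integral a b p∤b qb) (integral c d p∤d rd) =
    integral (a ℤ.* d ℤ.+ c ℤ.* b) (b ℤ.* d) (∤-* p∤b p∤d) (begin
      (q + r) * ι (b ℤ.* d)             ≡⟨ cong ((q + r) *_) (ι-* b d) ⟩
      (q + r) * (ι b * ι d)             ≡⟨ lem q r (ι b) (ι d) ⟩
      q * ι b * ι d + r * ι d * ι b     ≡⟨ cong₂ (λ v w → v * ι d + w * ι b) qb rd ⟩
      ι a * ι d + ι c * ι b             ≡⟨ sym (cong₂ _+_ (ι-* a d) (ι-* c b)) ⟩
      ι (a ℤ.* d) + ι (c ℤ.* b)         ≡⟨ sym (ι-+ (a ℤ.* d) (c ℤ.* b)) ⟩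
      ι (a ℤ.* d ℤ.+ c ℤ.* b)           ∎)
    where
    lem : ∀ q r b d → (q + r) * (b * d) ≡ q * b * d + r * d * b
    lem = solve-∀ ℚ-ring

  *-integral : ∀ {q r} → Integral q → Integral r → Integral (q * r)
  *-integral {q} {r} (integral a b p∤b qb) (integral c d p∤d rd) =
    integral (a ℤ.* c) (b ℤ.* d) (∤-* p∤b p∤d) (begin
      q * r * ι (b ℤ.* d)      ≡⟨ cong (q * r *_) (ι-* b d) ⟩
      q * r * (ι b * ι d)      ≡⟨ lem q r (ι b) (ι d) ⟩
      q * ι b * (r * ι d)      ≡⟨ cong₂ _*_ qb rd ⟩
      ι a * ι c                ≡⟨ sym (ι-* a c) ⟩
      ι (a ℤ.* c)              ∎)
    where
    lem : ∀ q r b d → q * r * (b * d) ≡ q * b * (r * d)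
    lem = solve-∀ ℚ-ring

  inv-integral : ∀ {q} u → ¬ (+ p ∣ u) → q ≡ ι u → Integral (inv q)
  inv-integral u p∤u refl = integral (+ 1) u p∤u
    (trans (ℚₚ.*-comm (inv (ι u)) (ι u)) (inv-inverseʳ (ι-≢0 {u} (λ { refl → p∤u (divides (+ 0) refl) }))))

  prod-integral : ∀ n {f} → (∀ {i} → i < n → Integral (f i)) → Integral (prod n f)
  prod-integral zero    If = ι-integral (+ 1)
  prod-integral (suc n) If = *-integral (prod-integral n (λ i<n → If (ℕₚ.m<n⇒m<1+n i<n))) (If ℕₚ.≤-refl)

  -- The submodule of ℚ generated by `m` over the localised integers; congruences modulo `m` are
  -- differences lying in it.
  record _∈⟨_⟩ (q m : ℚ) : Set where
    constructor multiple
    field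
      quot          : ℚ
      quot-integral : Integral quot
      q≡m*quot      : q ≡ m * quot

  ∈-* : ∀ {q m r} → q ∈⟨ m ⟩ → Integral r → (q * r) ∈⟨ m ⟩
  ∈-* {m = m} {r} (multiple s Is refl) Ir = multiple (s * r) (*-integral Is Ir) (ℚₚ.*-assoc m s r)

  ∈-+ : ∀ {q r m} → q ∈⟨ m ⟩ → r ∈⟨ m ⟩ → (q + r) ∈⟨ m ⟩
  ∈-+ {m = m} (multiple s Is refl) (multiple t It refl) = multiple (s + t) (+-integral Is It) (sym (ℚₚ.*-distribˡ-+ m s t))

  0∈ : ∀ m → 0ℚ ∈⟨ m ⟩
  0∈ m = multiple 0ℚ (ι-integral (+ 0)) (sym (ℚₚ.*-zeroʳ m))

  sum-≡-mod : ∀ n {f l m} → l < n → (∀ {i} → i < n → i ≢ l → f i ∈⟨ m ⟩) → (sumℚ n f - f l) ∈⟨ m ⟩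
  sum-≡-mod (suc n) {f} {l} {m} l<1+n f∈ with n ℕₚ.≟ l
  ... | yes refl = subst (_∈⟨ m ⟩) (lem (sumℚ n f) (f n)) (all∈ n (λ i<n → f∈ (ℕₚ.m<n⇒m<1+n i<n) (ℕₚ.<⇒≢ i<n)))
    where
    lem : ∀ a b → a ≡ a + b - b
    lem = solve-∀ ℚ-ring
    all∈ : ∀ n → (∀ {i} → i < n → f i ∈⟨ m ⟩) → sumℚ n f ∈⟨ m ⟩
    all∈ zero    f∈ = 0∈ m
    all∈ (suc n) f∈ = ∈-+ (all∈ n (λ i<n → f∈ (ℕₚ.m<n⇒m<1+n i<n))) (f∈ ℕₚ.≤-refl)
  ... | no n≢l = subst (_∈⟨ m ⟩) (lem (sumℚ n f) (f n) (f l))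
    (∈-+ (sum-≡-mod n (ℕₚ.≤∧≢⇒< (ℕₚ.≤-pred l<1+n) (λ l≡n → n≢l (sym l≡n))) (λ i<n → f∈ (ℕₚ.m<n⇒m<1+n i<n)))
         (f∈ ℕₚ.≤-refl n≢l))
    where
    lem : ∀ a b c → a - c + b ≡ a + b - c
    lem = solve-∀ ℚ-ring

  *-≡-mod : ∀ {a b c d m} → Integral a → Integral d → (a - b) ∈⟨ m ⟩ → (c - d) ∈⟨ m ⟩ → (a * c - b * d) ∈⟨ m ⟩
  *-≡-mod {a} {b} {c} {d} {m} Ia Id a≡b c≡d = subst (_∈⟨ m ⟩) (lem a b c d) (∈-+ (∈-* c≡d Ia) (∈-* a≡b Id))
    where
    lem : ∀ a b c d → (c - d) * a + (a - b) * d ≡ a * c - b * d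
    lem = solve-∀ ℚ-ring

  prod-≡-mod : ∀ n {f g m} → (∀ {i} → i < n → Integral (f i)) → (∀ {i} → i < n → Integral (g i)) →
    (∀ {i} → i < n → (f i - g i) ∈⟨ m ⟩) → (prod n f - prod n g) ∈⟨ m ⟩
  prod-≡-mod zero    If Ig f≡g = 0∈ _
  prod-≡-mod (suc n) If Ig f≡g = *-≡-mod (prod-integral n (λ i<n → If (ℕₚ.m<n⇒m<1+n i<n))) (Ig ℕₚ.≤-refl)
    (prod-≡-mod n (λ i<n → If (ℕₚ.m<n⇒m<1+n i<n)) (λ i<n → Ig (ℕₚ.m<n⇒m<1+n i<n)) (λ i<n → f≡g (ℕₚ.m<n⇒m<1+n i<n)))
    (f≡g ℕₚ.≤-refl)

  update-integral : ∀ {n f} l {v} → Integral v → (∀ {i} → i < n → i ≢ l → Integral (f i)) →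
    ∀ {i} → i < n → Integral (update f l v i)
  update-integral {n} {f} l {v} Iv If {i} i<n with i ℕₚ.≟ l
  ... | yes _  = Iv
  ... | no i≢l = If i<n i≢l

  -- Only the factor at `l` may have a denominator; it is taken out by putting 1 in its place, and
  -- `m` is spent on it alone.
  prod-integral-*ˡ : ∀ n {f} l {m} → l < n → Integral (m * f l) → (∀ {i} → i < n → i ≢ l → Integral (f i)) →
    Integral (m * prod n f)
  prod-integral-*ˡ n {f} l {m} l<n Il If = subst Integral (begin
    prod n (update f l 1ℚ) * (m * f l)  ≡⟨ lem₁ (prod n (update f l 1ℚ)) m (f l) ⟩
    m * (prod n (update f l 1ℚ) * f l)  ≡⟨ cong (m *_) (trans (prod-update f l 1ℚ l<n) (ℚₚ.*-identityʳ _)) ⟩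
    m * prod n f                        ∎)
    (*-integral (prod-integral n (update-integral l (ι-integral (+ 1)) If)) Il)
    where
    lem₁ : ∀ a b c → a * (b * c) ≡ b * (a * c)
    lem₁ = solve-∀ ℚ-ring

  prod-two-∈ : ∀ n {f i j m} → i < n → j < n → i ≢ j → (∀ {k} → k < n → Integral (f k)) →
    f i ∈⟨ m ⟩ → f j ∈⟨ m ⟩ → prod n f ∈⟨ m * m ⟩
  prod-two-∈ n {f} {i} {j} {m} i<n j<n i≢j If (multiple s Is fi≡) (multiple t It fj≡) =
    multiple (prod n h * (s * t)) (*-integral (prod-integral n Ih) (*-integral Is It)) (begin
      prod n f                       ≡⟨ sym (ℚₚ.*-identityʳ _) ⟩
      prod n f * 1ℚ                  ≡⟨ sym (prod-update f i 1ℚ i<n) ⟩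
      prod n g * f i                 ≡⟨ cong (_* f i) (sym (ℚₚ.*-identityʳ (prod n g))) ⟩
      prod n g * 1ℚ * f i            ≡⟨ cong (_* f i) (sym (prod-update g j 1ℚ j<n)) ⟩
      prod n h * g j * f i           ≡⟨ cong₂ (λ v w → prod n h * v * w) (trans (update-≢ f 1ℚ (λ j≡i → i≢j (sym j≡i))) fj≡) fi≡ ⟩
      prod n h * (m * t) * (m * s)   ≡⟨ lem (prod n h) m s t ⟩
      m * m * (prod n h * (s * t))   ∎)
    where
    g = update f i 1ℚ
    h = update g j 1ℚ
    Ih : ∀ {k} → k < n → Integral (h k)
    Ih = update-integral j (ι-integral (+ 1)) (λ k<n _ → update-integral i (ι-integral (+ 1)) (λ k<n _ → If k<n) k<n)
    lem : ∀ h m s t → h * (m * t) * (m * s) ≡ m * m * (h * (s * t))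
    lem = solve-∀ ℚ-ring

  record Unit (q : ℚ) : Set where
    constructor unit
    field
      q-integral  : Integral q
      recip       : ℚ
      r-integral  : Integral recip
      q*recip≡1   : q * recip ≡ 1ℚ

  ι-unit : ∀ {q} u → ¬ (+ p ∣ u) → q ≡ ι u → Unit q
  ι-unit u p∤u refl = unit (ι-integral u) (inv (ι u)) (inv-integral u p∤u refl)
    (inv-inverseʳ (ι-≢0 {u} (λ { refl → p∤u (divides (+ 0) refl) })))

  inv-unit : ∀ {q} u → ¬ (+ p ∣ u) → q ≡ ι u → Unit (inv q)
  inv-unit u p∤u refl = unit (inv-integral u p∤u refl) (ι u) (ι-integral u)
    (trans (ℚₚ.*-comm (inv (ι u)) (ι u)) (Unit.q*recip≡1 (ι-unit u p∤u refl)))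

  *-unit : ∀ {q r} → Unit q → Unit r → Unit (q * r)
  *-unit {q} {r} (unit Iq s Is qs) (unit Ir t It rt) = unit (*-integral Iq Ir) (s * t) (*-integral Is It)
    (trans (lem q r s t) (cong₂ _*_ qs rt))
    where
    lem : ∀ q r s t → q * r * (s * t) ≡ q * s * (r * t)
    lem = solve-∀ ℚ-ring

  prod-unit : ∀ n {f} → (∀ {i} → i < n → Unit (f i)) → Unit (prod n f)
  prod-unit zero    Uf = ι-unit (+ 1) p∤1 refl
  prod-unit (suc n) Uf = *-unit (prod-unit n (λ i<n → Uf (ℕₚ.m<n⇒m<1+n i<n))) (Uf ℕₚ.≤-refl)

  ∈-cancel : ∀ {q r m} → Unit r → (q * r) ∈⟨ m ⟩ → q ∈⟨ m ⟩
  ∈-cancel {q} {r} {m} (unit _ s Is rs) qr∈ = subst (_∈⟨ m ⟩) (begin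
    q * r * s    ≡⟨ ℚₚ.*-assoc q r s ⟩
    q * (r * s)  ≡⟨ cong (q *_) rs ⟩
    q * 1ℚ       ≡⟨ ℚₚ.*-identityʳ q ⟩
    q            ∎) (∈-* qr∈ Is)

  -- From the localisation back to reduced fractions.

  ∤⇒coprime : ∀ {d} → ¬ (p ℕ∣.∣ d) → Coprime d p
  ∤⇒coprime p∤d (e∣d , e∣p) with prime⇒irreducible isPrime e∣p
  ... | inj₁ e≡1  = e≡1
  ... | inj₂ refl = contradiction e∣d p∤d

  coprime-^ : ∀ {d} k → ¬ (p ℕ∣.∣ d) → Coprime d (p ^ k)
  coprime-^ zero    p∤d (e∣d , e∣1) = ℕ∣.∣1⇒≡1 e∣1
  coprime-^ (suc k) p∤d (e∣d , e∣p^k+1) =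
    coprime-^ k p∤d (e∣d , coprime-divisor (∤⇒coprime (λ p∣e → p∤d (ℕ∣.∣-trans p∣e e∣d))) e∣p^k+1)

  lowestTerms : ∀ q → Coprime ℤ.∣ ℚ.↥ q ∣ (ℚ.↧ₙ q)
  lowestTerms (ℚ.mkℚ n d c) = recompute c

  crossMultiply : ∀ q a d → q * ι d ≡ ι a → ℚ.↥ q ℤ.* d ≡ a ℤ.* ℚ.↧ q
  crossMultiply q@record{} a d eq
    with ≃-trans (≃-trans (ℚᵘₚ.*-cong (ℚᵘₚ.≃-refl {ℚ.toℚᵘ q}) (≃-sym (ι-toℚᵘ d))) (≃-sym (ℚₚ.toℚᵘ-homo-* q (ι d))))
           (≃-trans (ℚᵘₚ.≃-reflexive (cong ℚ.toℚᵘ eq)) (ι-toℚᵘ a))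
  ... | ℚᵘ.*≡* e = trans (sym (ℤₚ.*-identityʳ _)) (trans e (cong (λ n → a ℤ.* + n) (ℕₚ.*-identityʳ (ℚ.↧ₙ q))))

  -- The fraction at hand is compared with the reduced one by cross-multiplication. If `p` divided
  -- the reduced denominator it would divide the reduced numerator as well, since it does not divide
  -- `d`; and `p ^ k`, being coprime to `d`, must divide the reduced numerator.
  ∈⟨p^k⟩⇒≡-mod : ∀ {r s} k → (r - s) ∈⟨ ℕ→ℚ (p ^ k) ⟩ → r ≡ s [modℚ p ^ k ]
  ∈⟨p^k⟩⇒≡-mod {r} {s} k (multiple t (integral n d p∤d td) q≡) = M∣num , coprime-^ k p∤den
    where
    q = r - s
    M = p ^ k
    cross : ℚ.↥ q ℤ.* d ≡ + M ℤ.* n ℤ.* ℚ.↧ q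
    cross = crossMultiply q (+ M ℤ.* n) d (begin
      q * ι d                 ≡⟨ cong (_* ι d) q≡ ⟩
      ℕ→ℚ M * t * ι d         ≡⟨ ℚₚ.*-assoc (ℕ→ℚ M) t (ι d) ⟩
      ℕ→ℚ M * (t * ι d)       ≡⟨ cong (ℕ→ℚ M *_) td ⟩
      ℕ→ℚ M * ι n             ≡⟨ sym (ι-* (+ M) n) ⟩
      ι (+ M ℤ.* n)           ∎)
    p∤den : ¬ (p ℕ∣.∣ ℚ.↧ₙ q)
    p∤den p∣den = [ p∤num , p∤d ]′ (euclid (ℚ.↥ q) d (subst (+ p ∣_) (sym cross) (ℤ∣.∣n⇒∣m*n (+ M ℤ.* n) (∣ᵤ⇒∣ p∣den))))
      where
      p∤num : ¬ (+ p ∣ ℚ.↥ q)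
      p∤num p∣num = p∤1 (∣ᵤ⇒∣ (subst (p ℕ∣.∣_) (lowestTerms q (∣⇒∣ᵤ p∣num , p∣den)) ℕ∣.∣-refl))
    M∣num : M ℕ∣.∣ ℤ.∣ ℚ.↥ q ∣
    M∣num = coprime-divisor (Coprimality.sym (coprime-^ k (λ p∣d → p∤d (∣ᵤ⇒∣ p∣d))))
      (subst (M ℕ∣.∣_) (trans (cong ℤ.∣_∣ (trans (sym cross) (ℤₚ.*-comm (ℚ.↥ q) d))) (ℤₚ.abs-* d (ℚ.↥ q)))
        (∣⇒∣ᵤ (ℤ∣.∣m⇒∣m*n (ℚ.↧ q) (ℤ∣.∣m⇒∣m*n n (ℤ∣.∣-refl {+ M})))))

-- The congruence modulo p³

ι-- : ∀ i j → ι (i ℤ.- j) ≡ ι i - ι j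
ι-- i j = trans (ι-+ i (ℤ.- j)) (cong (λ z → ι i + z) (ι-neg j))

oddℤ sixℤ : ℕ → ℤ
oddℤ j = + suc (2 ℕ.* j)
sixℤ i = + (6 ℕ.* suc i)

ι-oddℤ² : ∀ j → ι (oddℤ j ℤ.* oddℤ j) ≡ oddSq j
ι-oddℤ² j = trans (ι-* (oddℤ j) (oddℤ j)) (cong₂ _*_ (odd≡ j) (odd≡ j))

ι-sixℤ² : ∀ i → ι (sixℤ i ℤ.* sixℤ i) ≡ sixSq i
ι-sixℤ² i = trans (ι-* (sixℤ i) (sixℤ i)) (cong₂ _*_ six six)
  where
  lem : ∀ I → ℕ→ℚ 6 * (I + 1ℚ) ≡ ℕ→ℚ 6 * I + ℕ→ℚ 6
  lem = solve-∀ ℚ-ring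
  six : ℕ→ℚ (6 ℕ.* suc i) ≡ ℕ→ℚ 6 * ℕ→ℚ i + ℕ→ℚ 6
  six = trans (ℕ→ℚ-* 6 (suc i)) (trans (cong (ℕ→ℚ 6 *_) (ℕ→ℚ-suc i)) (lem (ℕ→ℚ i)))

oddSq-0 : ∀ j → oddSq j - 0ℚ ≡ ι (oddℤ j ℤ.* oddℤ j)
oddSq-0 j = trans (ℚₚ.+-identityʳ (oddSq j)) (sym (ι-oddℤ² j))

sixSq-0 : ∀ i → sixSq i - 0ℚ ≡ ι (sixℤ i ℤ.* sixℤ i)
sixSq-0 i = trans (ℚₚ.+-identityʳ (sixSq i)) (sym (ι-sixℤ² i))

sixSq-oddSq : ∀ i l → sixSq i - oddSq l ≡ ι (sixℤ i ℤ.* sixℤ i ℤ.- oddℤ l ℤ.* oddℤ l)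
sixSq-oddSq i l = sym (trans (ι-- (sixℤ i ℤ.* sixℤ i) (oddℤ l ℤ.* oddℤ l)) (cong₂ _-_ (ι-sixℤ² i) (ι-oddℤ² l)))

oddSq-oddSq-ι : ∀ i j → oddSq i - oddSq j ≡ ι (+ 4 ℤ.* ((+ i ℤ.- + j) ℤ.* + suc (i ℕ.+ j)))
oddSq-oddSq-ι i j = trans (oddSq-oddSq i j) (sym (begin
  ι (+ 4 ℤ.* ((+ i ℤ.- + j) ℤ.* + suc (i ℕ.+ j)))        ≡⟨ ι-* (+ 4) ((+ i ℤ.- + j) ℤ.* + suc (i ℕ.+ j)) ⟩
  ℕ→ℚ 4 * ι ((+ i ℤ.- + j) ℤ.* + suc (i ℕ.+ j))          ≡⟨ cong (ℕ→ℚ 4 *_) (ι-* (+ i ℤ.- + j) (+ suc (i ℕ.+ j))) ⟩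
  ℕ→ℚ 4 * (ι (+ i ℤ.- + j) * ℕ→ℚ (suc (i ℕ.+ j)))
    ≡⟨ cong₂ (λ a b → ℕ→ℚ 4 * (a * b)) (ι-- (+ i) (+ j)) (trans (ℕ→ℚ-suc (i ℕ.+ j)) (cong (_+ 1ℚ) (ℕ→ℚ-+ i j))) ⟩
  ℕ→ℚ 4 * ((ℕ→ℚ i - ℕ→ℚ j) * (ℕ→ℚ i + ℕ→ℚ j + 1ℚ))       ∎))

-- Index `h` is the node x = p. Modulo `p`, `q` is an inverse of 6 or of -6; only squares are
-- compared, so the sign is left open and both classes of `p` modulo 6 are treated at once.
module Congruence (h q : ℕ) (isPrime : Prime (suc (2 ℕ.* h))) (3<p : 3 < suc (2 ℕ.* h))
  (q-inverts-6 : + suc (2 ℕ.* h) ∣ (+ 6 ℤ.* + q) ℤ.* (+ 6 ℤ.* + q) ℤ.- + 1) where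

  n p : ℕ
  n = 2 ℕ.* h
  p = suc n

  P : ℚ
  P = ℕ→ℚ p

  open Localisation isPrime
  open Interpolation n

  ∣⇒≡p : ∀ {m} → suc m < p ℕ.+ p → + p ∣ + suc m → suc m ≡ p
  ∣⇒≡p {m} m<2p p∣m with ∣⇒∣ᵤ p∣m
  ... | ℕ∣.divides 1 eq = trans eq (ℕₚ.*-identityˡ p)
  ... | ℕ∣.divides (suc (suc c)) eq = contradiction m<2p (ℕₚ.≤⇒≯ (subst (p ℕ.+ p ≤_) (sym eq)
          (ℕₚ.+-monoʳ-≤ p (ℕₚ.m≤m+n p (c ℕ.* p)))))

  p∤4 : ¬ (+ p ∣ + 4)
  p∤4 = ∤-small {+ 4} (ℕₚ.≤∧≢⇒< 3<p (ℕₚ.even≢odd 2 h)) (λ ())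

  p∤sixℤ : ∀ {i} → i < n → ¬ (+ p ∣ sixℤ i)
  p∤sixℤ {i} i<n p∣6i = ∤-* {+ 6} (∤-* {+ 2} (∤-small {+ 2} (ℕₚ.<-trans (ℕₚ.n<1+n 2) 3<p) (λ ())) (∤-small {+ 3} 3<p (λ ())))
    (∤-small {+ suc i} (ℕ.s≤s i<n) (λ ())) (subst (+ p ∣_) (ℤₚ.pos-* 6 (suc i)) p∣6i)

  p∤oddℤ : ∀ {j} → j < p → j ≢ h → ¬ (+ p ∣ oddℤ j)
  p∤oddℤ {j} j<p j≢h p∣ = j≢h (ℕₚ.*-cancelˡ-≡ j h 2 (ℕₚ.suc-injective (∣⇒≡p
    (subst (suc (2 ℕ.* j) <_) (cong (p ℕ.+_) (ℕₚ.+-identityʳ p)) (ℕₚ.≤-trans (ℕₚ.≤-reflexive (sym (ℕₚ.*-suc 2 j))) (ℕₚ.*-monoʳ-≤ 2 j<p))) p∣)))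

  p∤4[i-j] : ∀ {i j} → i < p → j < p → i ≢ j → ¬ (+ p ∣ + 4 ℤ.* (+ i ℤ.- + j))
  p∤4[i-j] i<p j<p i≢j = ∤-* p∤4 (p∤difference i<p j<p i≢j)

  p∤4[i-j][i+j+1] : ∀ {i j} → i < p → j < p → i ≢ j → i ℕ.+ j ≢ n → ¬ (+ p ∣ + 4 ℤ.* ((+ i ℤ.- + j) ℤ.* + suc (i ℕ.+ j)))
  p∤4[i-j][i+j+1] {i} {j} i<p j<p i≢j i+j≢n = ∤-* p∤4 (∤-* (p∤difference i<p j<p i≢j)
    (λ p∣ → i+j≢n (ℕₚ.suc-injective (∣⇒≡p (ℕₚ.+-mono-≤-< i<p j<p) p∣))))

  h<p : h < p
  h<p = ℕ.s≤s (ℕₚ.m≤m+n h (h ℕ.+ 0))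

  sixSq-X-integral : ∀ i l → Integral (sixSq i - oddSq l)
  sixSq-X-integral i l = subst Integral (sym (sixSq-oddSq i l)) (ι-integral (sixℤ i ℤ.* sixℤ i ℤ.- oddℤ l ℤ.* oddℤ l))

  -- In the difference 4(j-l)(j+l+1) only the last factor can be divisible by `p`, and only when
  -- j+l+1 = p. The alternative `j ≡ l` serves the centre `l = h`, where j+l = n happens exactly at
  -- j = l and the factor is `inv 0ℚ = 1ℚ`.
  inv-diff-integral : ∀ {j l} → j < p → l < p → j ℕ.+ l ≢ n ⊎ j ≡ l → Integral (inv (oddSq j - oddSq l))
  inv-diff-integral {j} {l} j<p l<p j+l≢n with j ℕₚ.≟ l
  ... | yes refl = subst (λ z → Integral (inv z)) (sym (ℚₚ.+-inverseʳ (oddSq j))) (ι-integral (+ 1))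
  inv-diff-integral {j} {l} j<p l<p (inj₁ j+l≢n) | no j≢l = inv-integral _ (p∤4[i-j][i+j+1] j<p l<p j≢l j+l≢n) (oddSq-oddSq-ι j l)
  inv-diff-integral {j} {l} j<p l<p (inj₂ j≡l)   | no j≢l = contradiction j≡l j≢l

  -- The factor j = p - 1 - l is the only one with a denominator p, because (2j+1)+(2l+1) = 2p.
  p*inv-prod-integral : ∀ {l} → l < p → l ≢ h → Integral (P * prod p (λ j → inv (oddSq j - oddSq l)))
  p*inv-prod-integral {l} l<p l≢h = prod-integral-*ˡ p j₀ {P} (ℕ.s≤s (ℕₚ.m∸n≤m n l)) special
    (λ {j} j<p j≢j₀ → inv-diff-integral j<p l<p (inj₁ (λ e → j≢j₀ (trans (sym (ℕₚ.m+n∸n≡m j l)) (cong (_∸ l) e)))))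
    where
    j₀ = n ∸ l
    j₀+l≡n : j₀ ℕ.+ l ≡ n
    j₀+l≡n = ℕₚ.m∸n+n≡m (ℕₚ.≤-pred l<p)
    j₀≢l : j₀ ≢ l
    j₀≢l e = l≢h (ℕₚ.*-cancelˡ-≡ l h 2 (trans (cong (l ℕ.+_) (ℕₚ.+-identityʳ l)) (trans (cong (ℕ._+ l) (sym e)) j₀+l≡n)))
    e = + 4 ℤ.* (+ j₀ ℤ.- + l)
    p∤e : ¬ (+ p ∣ e)
    p∤e = p∤4[i-j] (ℕ.s≤s (ℕₚ.m∸n≤m n l)) l<p j₀≢l
    e≢0 : ι e ≢ 0ℚ
    e≢0 = ι-≢0 {e} (λ e≡0 → p∤e (divides (+ 0) e≡0))
    diff : oddSq j₀ - oddSq l ≡ ι e * P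
    diff = trans (oddSq-oddSq-ι j₀ l) (trans
      (cong ι (trans (cong (λ m → + 4 ℤ.* ((+ j₀ ℤ.- + l) ℤ.* + suc m)) j₀+l≡n) (sym (ℤₚ.*-assoc (+ 4) (+ j₀ ℤ.- + l) (+ p)))))
      (ι-* e (+ p)))
    lem : ∀ i e P → i * (e * P) ≡ e * i * P
    lem = solve-∀ ℚ-ring
    special : Integral (P * inv (oddSq j₀ - oddSq l))
    special = subst Integral (sym (trans (cong (λ d → P * inv d) diff)
      (*-inv-unique (*-≢0 e≢0 (ℕ→ℚ-≢0 n)) (sym (trans (lem (inv (ι e)) (ι e) P) (trans (cong (_* P) (inv-inverseʳ e≢0)) (ℚₚ.*-identityˡ P)))))))
      (inv-integral e p∤e refl)

  p∤q : ¬ (+ p ∣ + q)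
  p∤q p∣q = p∤1 (subst (+ p ∣_) (lem (+ q)) (ℤ∣.∣m∣n⇒∣m-n (ℤ∣.∣m⇒∣m*n (+ 36 ℤ.* + q) p∣q) q-inverts-6))
    where
    lem : ∀ q → q ℤ.* (+ 36 ℤ.* q) ℤ.- ((+ 6 ℤ.* q) ℤ.* (+ 6 ℤ.* q) ℤ.- + 1) ≡ + 1
    lem = ℤ-Solver.solve-∀

  p∣⇒∈⟨P⟩ : ∀ {r} z → r ≡ ι z → + p ∣ z → r ∈⟨ P ⟩
  p∣⇒∈⟨P⟩ z refl (divides c refl) = multiple (ι c) (ι-integral c) (trans (ι-* c (+ p)) (ℚₚ.*-comm (ι c) P))

  -- With m = 2l+1, the congruence (6a)² ≡ m² has the solutions a and p - a, where a is the
  -- remainder of q m. Here a is not 0 because `l ≢ h` keeps m prime to `p`, and a ≠ p - a because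
  -- `p` is odd. They give the two indices a - 1 and p - a - 1.
  six-prod-∈ : ∀ {l} → l < p → l ≢ h → prod n (λ i → sixSq i - oddSq l) ∈⟨ P * P ⟩
  six-prod-∈ {l} l<p l≢h = go ((q ℕ.* m) % p) (m%n<n (q ℕ.* m) p) (m≡m%n+[m/n]*n (q ℕ.* m) p)
    where
    m = suc (2 ℕ.* l)
    t = (q ℕ.* m) ℕ./ p
    go : ∀ a → a < p → q ℕ.* m ≡ a ℕ.+ t ℕ.* p → prod n (λ i → sixSq i - oddSq l) ∈⟨ P * P ⟩
    go zero a<p qm≡ = contradiction (divides (+ t) (trans (sym (ℤₚ.pos-* q m)) (trans (cong +_ qm≡) (ℤₚ.pos-* t p))))
      (∤-* p∤q (p∤oddℤ l<p l≢h))
    go (suc i) (ℕ.s≤s i<n) qm≡ = prod-two-∈ n i<n i′<n i≢i′ (λ {k} _ → sixSq-X-integral k l)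
      (p∣⇒∈⟨P⟩ _ (sixSq-oddSq i l) p∣i) (p∣⇒∈⟨P⟩ _ (sixSq-oddSq i′ l) p∣i′)
      where
      i′ = n ∸ suc i
      i+i′ : suc i ℕ.+ i′ ≡ n
      i+i′ = ℕₚ.m+[n∸m]≡n i<n
      i′<n : i′ < n
      i′<n = subst (i′ <_) i+i′ (ℕₚ.m<n+m i′ (ℕ.s≤s ℕ.z≤n))
      i≢i′ : i ≢ i′
      i≢i′ e = ℕₚ.even≢odd h i (trans (sym i+i′) (cong suc (cong (i ℕ.+_) (trans (sym e) (sym (ℕₚ.+-identityʳ i))))))
      A = + suc i
      M = + m
      qm≡ℤ : + q ℤ.* M ≡ A ℤ.+ + t ℤ.* + p
      qm≡ℤ = trans (sym (ℤₚ.pos-* q m)) (trans (cong +_ qm≡) (cong (λ z → A ℤ.+ z) (ℤₚ.pos-* t p)))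
      -- The first two summands vanish, by A = qM - tp and 36q² - 1 = rp; the third displays the
      -- quotient by `p`.
      lem₁ : ∀ A M q r t p → (+ 6 ℤ.* A) ℤ.* (+ 6 ℤ.* A) ℤ.- M ℤ.* M ≡
        (A ℤ.+ t ℤ.* p ℤ.- q ℤ.* M) ℤ.* (+ 36 ℤ.* (A ℤ.- t ℤ.* p ℤ.+ q ℤ.* M))
        ℤ.+ M ℤ.* M ℤ.* ((+ 6 ℤ.* q) ℤ.* (+ 6 ℤ.* q) ℤ.- + 1 ℤ.- r ℤ.* p)
        ℤ.+ (M ℤ.* M ℤ.* r ℤ.- + 72 ℤ.* q ℤ.* M ℤ.* t ℤ.+ + 36 ℤ.* t ℤ.* t ℤ.* p) ℤ.* p
      lem₁ = ℤ-Solver.solve-∀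
      p∣A : + p ∣ (+ 6 ℤ.* A) ℤ.* (+ 6 ℤ.* A) ℤ.- M ℤ.* M
      p∣A = multiple-of-p q-inverts-6
        where
        lem₂ : ∀ a b c → + 0 ℤ.* a ℤ.+ b ℤ.* + 0 ℤ.+ c ≡ c
        lem₂ = ℤ-Solver.solve-∀
        multiple-of-p : + p ∣ (+ 6 ℤ.* + q) ℤ.* (+ 6 ℤ.* + q) ℤ.- + 1 → + p ∣ (+ 6 ℤ.* A) ℤ.* (+ 6 ℤ.* A) ℤ.- M ℤ.* M
        multiple-of-p (divides r r≡) = divides c (trans (lem₁ A M (+ q) r (+ t) (+ p)) (trans
          (cong₂ (λ u v → u ℤ.* (+ 36 ℤ.* (A ℤ.- + t ℤ.* + p ℤ.+ + q ℤ.* M)) ℤ.+ M ℤ.* M ℤ.* v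
             ℤ.+ (M ℤ.* M ℤ.* r ℤ.- + 72 ℤ.* + q ℤ.* M ℤ.* + t ℤ.+ + 36 ℤ.* + t ℤ.* + t ℤ.* + p) ℤ.* + p)
            (ℤₚ.i≡j⇒i-j≡0 (sym qm≡ℤ))
            (ℤₚ.i≡j⇒i-j≡0 r≡))
          (lem₂ (+ 36 ℤ.* (A ℤ.- + t ℤ.* + p ℤ.+ + q ℤ.* M)) (M ℤ.* M) (c ℤ.* + p))))
          where c = M ℤ.* M ℤ.* r ℤ.- + 72 ℤ.* + q ℤ.* M ℤ.* + t ℤ.+ + 36 ℤ.* + t ℤ.* + t ℤ.* + p
      p∣i : + p ∣ sixℤ i ℤ.* sixℤ i ℤ.- M ℤ.* M
      p∣i = subst (λ z → + p ∣ z ℤ.* z ℤ.- M ℤ.* M) (sym (ℤₚ.pos-* 6 (suc i))) p∣A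
      A+B : + suc i′ ≡ + p ℤ.- A
      A+B = trans (lem A (+ suc i′)) (cong (ℤ._- A) (cong +_ (trans (ℕₚ.+-suc (suc i) i′) (cong suc i+i′))))
        where
        lem : ∀ A B → B ≡ A ℤ.+ B ℤ.- A
        lem = ℤ-Solver.solve-∀
      p∣i′ : + p ∣ sixℤ i′ ℤ.* sixℤ i′ ℤ.- M ℤ.* M
      p∣i′ = subst (+ p ∣_) (trans (sym (lem A M (+ p))) (cong (λ z → z ℤ.* z ℤ.- M ℤ.* M)
          (trans (cong (λ z → + 6 ℤ.* z) (sym A+B)) (sym (ℤₚ.pos-* 6 (suc i′))))))
        (ℤ∣.∣m∣n⇒∣m+n p∣A (ℤ∣.∣n⇒∣m*n (+ 36 ℤ.* + p ℤ.- + 72 ℤ.* A) (ℤ∣.∣-refl {+ p})))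
        where
        lem : ∀ A M p → (+ 6 ℤ.* (p ℤ.- A)) ℤ.* (+ 6 ℤ.* (p ℤ.- A)) ℤ.- M ℤ.* M ≡
          (+ 6 ℤ.* A) ℤ.* (+ 6 ℤ.* A) ℤ.- M ℤ.* M ℤ.+ (+ 36 ℤ.* p ℤ.- + 72 ℤ.* A) ℤ.* p
        lem = ℤ-Solver.solve-∀

  oddSq-h≡P² : oddSq h ≡ P * P
  oddSq-h≡P² = cong₂ _*_ (sym (odd≡ h)) (sym (odd≡ h))

  P²*inv≡1 : P * P * inv (oddSq h - 0ℚ) ≡ 1ℚ
  P²*inv≡1 = trans (cong (_* inv (oddSq h - 0ℚ)) (trans (sym oddSq-h≡P²) (sym (ℚₚ.+-identityʳ (oddSq h)))))
    (inv-inverseʳ (oddSq≢0 h))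

  inv-oddSq-integral : ∀ {j} → j < p → j ≢ h → Integral (inv (oddSq j - 0ℚ))
  inv-oddSq-integral {j} j<p j≢h = inv-integral (oddℤ j ℤ.* oddℤ j) (∤-* (p∤oddℤ j<p j≢h) (p∤oddℤ j<p j≢h)) (oddSq-0 j)

  -- The prefactor `P * P` is the one that makes `nodeProd 0ℚ` a unit. Powers of `p`: two from it,
  -- two from `six-prod-∈`, and one lost to the node at 2p - x.
  weight-∈ : ∀ {l} → l < p → l ≢ h → (P * P * weight l) ∈⟨ P * (P * P) ⟩
  weight-∈ {l} l<p l≢h = scale (six-prod-∈ l<p l≢h)
    where
    I = prod p (λ j → inv (oddSq j - oddSq l))
    lem : ∀ P s I v → P * P * (P * P * s * I * v) ≡ P * (P * P) * (s * (P * I) * v)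
    lem = solve-∀ ℚ-ring
    scale : ∀ {S} → S ∈⟨ P * P ⟩ → (P * P * (S * I * inv (oddSq l - 0ℚ))) ∈⟨ P * (P * P) ⟩
    scale (multiple s Is S≡) = multiple (s * (P * I) * inv (oddSq l - 0ℚ))
      (*-integral (*-integral Is (p*inv-prod-integral l<p l≢h)) (inv-oddSq-integral l<p l≢h))
      (trans (cong (λ S → P * P * (S * I * inv (oddSq l - 0ℚ))) S≡) (lem P s I (inv (oddSq l - 0ℚ))))

  invSq : ℕ → ℚ
  invSq j = inv (oddSq j - 0ℚ)

  -- `nodeProd 0ℚ` without the factor 1/p² of the node x = p. It stands on both sides of the final
  -- comparison and is cancelled as a unit, so its value is never computed.
  reduced : ℚ
  reduced = prod n (λ i → sixSq i - 0ℚ) * prod p (update invSq h 1ℚ)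

  reduced-unit : Unit reduced
  reduced-unit = *-unit
    (prod-unit n (λ {i} i<n → ι-unit (sixℤ i ℤ.* sixℤ i) (∤-* (p∤sixℤ i<n) (p∤sixℤ i<n)) (sixSq-0 i)))
    (prod-unit p factor)
    where
    factor : ∀ {j} → j < p → Unit (update invSq h 1ℚ j)
    factor {j} j<p with j ℕₚ.≟ h
    ... | yes _  = ι-unit (+ 1) p∤1 refl
    ... | no j≢h = inv-unit (oddℤ j ℤ.* oddℤ j) (∤-* (p∤oddℤ j<p j≢h) (p∤oddℤ j<p j≢h)) (oddSq-0 j)

  P²*nodeProd≡reduced : P * P * nodeProd 0ℚ ≡ reduced
  P²*nodeProd≡reduced = begin
    P * P * (S * prod p invSq)                               ≡⟨ lem₁ P S (prod p invSq) ⟩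
    P * P * S * (prod p invSq * 1ℚ)                          ≡⟨ cong (P * P * S *_) (sym (prod-update invSq h 1ℚ h<p)) ⟩
    P * P * S * (prod p (update invSq h 1ℚ) * invSq h)       ≡⟨ lem₂ P S (prod p (update invSq h 1ℚ)) (invSq h) ⟩
    S * prod p (update invSq h 1ℚ) * (P * P * invSq h)       ≡⟨ cong (reduced *_) P²*inv≡1 ⟩
    reduced * 1ℚ                                             ≡⟨ ℚₚ.*-identityʳ reduced ⟩
    reduced                                                  ∎
    where
    S = prod n (λ i → sixSq i - 0ℚ)
    lem₁ : ∀ P S I → P * P * (S * I) ≡ P * P * S * (I * 1ℚ)
    lem₁ = solve-∀ ℚ-ring
    lem₂ : ∀ P S u v → P * P * S * (u * v) ≡ S * u * (P * P * v)
    lem₂ = solve-∀ ℚ-ring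

  P²*weight≡nodeProd : P * P * weight h ≡ nodeProd (oddSq h)
  P²*weight≡nodeProd = trans (lem P (nodeProd (oddSq h)) (invSq h))
    (trans (cong (nodeProd (oddSq h) *_) P²*inv≡1) (ℚₚ.*-identityʳ _))
    where
    lem : ∀ P a i → P * P * (a * i) ≡ a * (P * P * i)
    lem = solve-∀ ℚ-ring

  shift-∈ : ∀ X → (X - oddSq h - (X - 0ℚ)) ∈⟨ P * P ⟩
  shift-∈ X = multiple (- 1ℚ) (ι-integral -[1+ 0 ]) (trans (cong (λ v → X - v - (X - 0ℚ)) oddSq-h≡P²) (lem X P))
    where
    lem : ∀ X P → X - P * P - (X - 0ℚ) ≡ P * P * - 1ℚ
    lem = solve-∀ ℚ-ring

  -- Moving X from 0 to p² changes every difference by p², and the products are compared factor by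
  -- factor. At the node `h` both sides have the factor 1: once as `inv 0ℚ`, once through `update`.
  nodeProd-≡-mod : (nodeProd (oddSq h) - reduced) ∈⟨ P * P ⟩
  nodeProd-≡-mod = *-≡-mod
    (prod-integral n (λ {i} _ → sixSq-X-integral i h))
    (prod-integral p (update-integral h (ι-integral (+ 1)) inv-oddSq-integral))
    (prod-≡-mod n (λ {i} _ → sixSq-X-integral i h) (λ {i} _ → subst Integral (sym (sixSq-0 i)) (ι-integral (sixℤ i ℤ.* sixℤ i)))
      (λ {i} _ → shift-∈ (sixSq i)))
    (prod-≡-mod p inv-h-integral (update-integral h (ι-integral (+ 1)) inv-oddSq-integral) inv-≡-mod)
    where
    inv-h-integral : ∀ {j} → j < p → Integral (inv (oddSq j - oddSq h))
    inv-h-integral {j} j<p = inv-diff-integral j<p h<p (position (j ℕₚ.≟ h))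
      where
      position : Dec (j ≡ h) → j ℕ.+ h ≢ n ⊎ j ≡ h
      position (yes j≡h) = inj₂ j≡h
      position (no  j≢h) = inj₁ (λ e → j≢h (ℕₚ.+-cancelʳ-≡ h j h (trans e (cong (h ℕ.+_) (ℕₚ.+-identityʳ h)))))
    inv-≡-mod : ∀ {j} → j < p → (inv (oddSq j - oddSq h) - update invSq h 1ℚ j) ∈⟨ P * P ⟩
    inv-≡-mod {j} j<p = cases (j ℕₚ.≟ h)
      where
      x = oddSq j
      y = oddSq h
      a = inv (x - y)
      b = inv (x - 0ℚ)
      lem₁ : ∀ a b → a - b ≡ a * 1ℚ - b * 1ℚ
      lem₁ = solve-∀ ℚ-ring
      -- This is 1/(x-y) - 1/x = y/((x-y)x), used with y = p².
      lem₂ : ∀ x y a b → a * ((x - 0ℚ) * b) - b * ((x - y) * a) ≡ y * (a * b)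
      lem₂ = solve-∀ ℚ-ring
      cases : Dec (j ≡ h) → (a - update invSq h 1ℚ j) ∈⟨ P * P ⟩
      cases (yes j≡h) = subst (_∈⟨ P * P ⟩) (sym (cong₂ _-_
        (cong inv (trans (cong (λ i → oddSq i - y) j≡h) (ℚₚ.+-inverseʳ y)))
        (trans (cong (update invSq h 1ℚ) j≡h) (update-≡ invSq h 1ℚ)))) (0∈ (P * P))
      cases (no j≢h) = multiple (a * b) (*-integral (inv-h-integral j<p) (inv-oddSq-integral j<p j≢h)) (begin
        a - update invSq h 1ℚ j            ≡⟨ cong (λ v → a - v) (update-≢ invSq 1ℚ j≢h) ⟩
        a - b                              ≡⟨ lem₁ a b ⟩
        a * 1ℚ - b * 1ℚ                    ≡⟨ sym (cong₂ (λ u v → a * u - b * v) (inv-inverseʳ (oddSq≢0 j)) (inv-inverseʳ (oddSq-distinct j≢h))) ⟩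
        a * ((x - 0ℚ) * b) - b * ((x - y) * a)   ≡⟨ lem₂ x y a b ⟩
        y * (a * b)                        ≡⟨ cong (_* (a * b)) oddSq-h≡P² ⟩
        P * P * (a * b)                    ∎)

  -- This rests on the closed form: the single values `term (oddSq l) k` can have `p` in the
  -- denominator.
  series-integral : ∀ {l} → l < p → Integral (series (oddSq l) p)
  series-integral {l} l<p = subst Integral (sym (trans (series-oddSq l l<p) (cong (_* ι (χ l)) (sym (odd≡ l)))))
    (*-integral (ι-integral (oddℤ l)) (ι-integral (χ l)))

  -- The interpolation formula times p² reads S(0) `reduced` = ∑ `F l`. The terms off the centre
  -- vanish modulo p³; in `F h` the node product is exchanged for `reduced` modulo p², which is
  -- enough because S(p²) contributes another factor `p`.
  series-0-≡-mod : (series 0ℚ p - P * ι (χ h)) ∈⟨ P * (P * P) ⟩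
  series-0-≡-mod = ∈-cancel reduced-unit (subst (_∈⟨ P * (P * P) ⟩) total (∈-+ off-centre centre))
    where
    c = ι (χ h)
    F : ℕ → ℚ
    F l = series (oddSq l) p * weight l * (P * P)
    off-centre : (sumℚ p F - F h) ∈⟨ P * (P * P) ⟩
    off-centre = sum-≡-mod p h<p (λ {l} l<p l≢h →
      subst (_∈⟨ P * (P * P) ⟩) (lem P (weight l) (series (oddSq l) p)) (∈-* (weight-∈ l<p l≢h) (series-integral l<p)))
      where
      lem : ∀ P w s → P * P * w * s ≡ s * w * (P * P)
      lem = solve-∀ ℚ-ring
    centre : (P * c * (nodeProd (oddSq h) - reduced)) ∈⟨ P * (P * P) ⟩
    centre = scale nodeProd-≡-mod
      where
      lem : ∀ P c s → P * c * (P * P * s) ≡ P * (P * P) * (c * s)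
      lem = solve-∀ ℚ-ring
      scale : ∀ {d} → d ∈⟨ P * P ⟩ → (P * c * d) ∈⟨ P * (P * P) ⟩
      scale (multiple s Is eq) = multiple (c * s) (*-integral (ι-integral (χ h)) Is) (trans (cong (P * c *_) eq) (lem P c s))
    F-h : F h ≡ P * c * nodeProd (oddSq h)
    F-h = trans (ℚₚ.*-assoc (series (oddSq h) p) (weight h) (P * P)) (cong₂ _*_
      (trans (series-oddSq h h<p) (cong (_* c) (sym (odd≡ h))))
      (trans (ℚₚ.*-comm (weight h) (P * P)) P²*weight≡nodeProd))
    sum-F : sumℚ p F ≡ series 0ℚ p * reduced
    sum-F = begin
      sumℚ p F                                ≡⟨ sym (sum-*ʳ p (λ l → series (oddSq l) p * weight l) (P * P)) ⟩
      sumℚ p (λ l → series (oddSq l) p * weight l) * (P * P)   ≡⟨ cong (_* (P * P)) (sym series-interpolation) ⟩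
      series 0ℚ p * nodeProd 0ℚ * (P * P)     ≡⟨ ℚₚ.*-assoc (series 0ℚ p) _ _ ⟩
      series 0ℚ p * (nodeProd 0ℚ * (P * P))   ≡⟨ cong (series 0ℚ p *_) (trans (ℚₚ.*-comm (nodeProd 0ℚ) (P * P)) P²*nodeProd≡reduced) ⟩
      series 0ℚ p * reduced                   ∎
    total : sumℚ p F - F h + P * c * (nodeProd (oddSq h) - reduced) ≡ (series 0ℚ p - P * c) * reduced
    total = trans (cong₂ (λ u v → u - v + P * c * (nodeProd (oddSq h) - reduced)) sum-F F-h)
      (lem (series 0ℚ p) (P * c) reduced (nodeProd (oddSq h)))
      where
      lem : ∀ s c r v → s * r - c * v + c * (v - r) ≡ (s - c) * r
      lem = solve-∀ ℚ-ring

-- The Legendre symbol of -3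

if-any-cong : ∀ {P P′ : ℕ → Bool} xs {i j : ℤ} → (∀ x → P x ≡ P′ x) →
  (if any P xs then i else j) ≡ (if any P′ xs then i else j)
if-any-cong xs {i} {j} P≡P′ = cong (λ bs → if or bs then i else j) (map-cong P≡P′ xs)

-- The predicate isZero is local to legendre and cannot be named here: the type of this lemma is
-- inferred from its use in legendre-suc.
isZero≡ : ∀ a n x → _
legendre-suc : ∀ a n → legendre a (suc n) ≡
  (if (a %ℕ suc n) ≡ᵇ 0 then + 0
   else if any (λ x → (((+ x) ℤ.* (+ x) ℤ.- a) %ℕ suc n) ≡ᵇ 0) (upTo (suc n)) then + 1 else -[1+ 0 ])
-- The second expression is the test at x = 0, the head of `upTo (suc n)`; the third is the tail of
-- that list.
legendre-suc a n with a %ℕ suc n | ((+ 0 ℤ.- a) %ℕ suc n) | applyUpTo ℕ.suc n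
... | zero  | _     | _  = refl
... | suc _ | zero  | _  = refl
... | suc _ | suc _ | xs = if-any-cong xs (isZero≡ a n)
isZero≡ a n x with ((+ x) ℤ.* (+ x) ℤ.- a) %ℕ suc n
... | zero  = refl
... | suc _ = refl

applyUpTo-none : ∀ (P : ℕ → Bool) f n → any P (applyUpTo f n) ≡ false → ∀ x → x < n → P (f x) ≡ false
applyUpTo-none P f (suc n) eq x x<n with P (f 0) in P0
applyUpTo-none P f (suc n) eq zero    _ | false = P0
applyUpTo-none P f (suc n) eq (suc x) (ℕ.s≤s x<n) | false = applyUpTo-none P (λ y → f (suc y)) n eq x x<n

none-applyUpTo : ∀ (P : ℕ → Bool) f n → (∀ x → x < n → P (f x) ≡ false) → any P (applyUpTo f n) ≡ false
none-applyUpTo P f zero    none = refl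
none-applyUpTo P f (suc n) none =
  trans (cong (_∨ any P (applyUpTo (λ y → f (suc y)) n)) (none 0 (ℕ.s≤s ℕ.z≤n))) (none-applyUpTo P (λ y → f (suc y)) n (λ x x<n → none (suc x) (ℕ.s≤s x<n)))

≢0⇒≡ᵇ0 : ∀ {n} → n ≢ 0 → (n ≡ᵇ 0) ≡ false
≢0⇒≡ᵇ0 {zero}  n≢0 = contradiction refl n≢0
≢0⇒≡ᵇ0 {suc n} n≢0 = refl

module _ (a : ℤ) (n : ℕ) (a≢0 : a %ℕ suc n ≢ 0) where

  residual : ℕ → ℕ
  residual x = ((+ x) ℤ.* (+ x) ℤ.- a) %ℕ suc n

  legendre-any : legendre a (suc n) ≡ (if any (λ x → residual x ≡ᵇ 0) (upTo (suc n)) then + 1 else -[1+ 0 ])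
  legendre-any = trans (legendre-suc a n)
    (cong (λ b → if b then + 0 else if any (λ x → residual x ≡ᵇ 0) (upTo (suc n)) then + 1 else -[1+ 0 ]) (≢0⇒≡ᵇ0 a≢0))

  -- A negated universal suffices because the search is finite and decides; the orbit count only
  -- refutes the absence of a root.
  legendre≡+1 : ¬ (∀ x → x < suc n → residual x ≢ 0) → legendre a (suc n) ≡ + 1
  legendre≡+1 some with any (λ x → residual x ≡ᵇ 0) (upTo (suc n)) in eq | legendre-any
  ... | true  | l = l
  ... | false | _ = contradiction (λ x x<n r≡0 → true≢false (trans (cong (_≡ᵇ 0) (sym r≡0)) (applyUpTo-none (λ x → residual x ≡ᵇ 0) (λ y → y) (suc n) eq x x<n))) some
    where
    true≢false : true ≢ false
    true≢false ()

  legendre≡-1 : (∀ x → x < suc n → residual x ≢ 0) → legendre a (suc n) ≡ -[1+ 0 ]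
  legendre≡-1 none = trans legendre-any (cong (if_then + 1 else -[1+ 0 ])
    (none-applyUpTo (λ x → residual x ≡ᵇ 0) (λ y → y) (suc n) (λ x x<n → ≢0⇒≡ᵇ0 (none x x<n))))

-- Counting orbits of permutations of order three.

indicator : ∀ {A : Set} → Dec A → ℕ
indicator (yes _) = 1
indicator (no _)  = 0

indicator-yes : ∀ {A : Set} (d : Dec A) → A → indicator d ≡ 1
indicator-yes (yes _) a = refl
indicator-yes (no ¬a) a = contradiction a ¬a

indicator-no : ∀ {A : Set} (d : Dec A) → ¬ A → indicator d ≡ 0
indicator-no (yes a) ¬a = contradiction a ¬a
indicator-no (no _)  ¬a = refl

⟦_<_⟧ : ℕ → ℕ → ℕ
⟦ a < b ⟧ = indicator (a ℕₚ.<? b)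

isMin : ℕ → ℕ → ℕ → ℕ
isMin a b c = ⟦ a < b ⟧ ℕ.* ⟦ a < c ⟧

-- Of the eight outcomes of the three comparisons, two are cyclic and contradict transitivity; in
-- each of the other six the sum is evaluated by `count`.
one-min : ∀ {a b c} → a ≢ b → b ≢ c → a ≢ c → isMin a b c ℕ.+ (isMin b c a ℕ.+ isMin c a b) ≡ 1
one-min {a} {b} {c} a≢b b≢c a≢c = cases (ℕₚ.<-cmp a b) (ℕₚ.<-cmp b c) (ℕₚ.<-cmp a c)
  where
  yes< : ∀ {a b} → a < b → ⟦ a < b ⟧ ≡ 1
  yes< {a} {b} = indicator-yes (a ℕₚ.<? b)
  no≮ : ∀ {a b} → ¬ (a < b) → ⟦ a < b ⟧ ≡ 0
  no≮ {a} {b} = indicator-no (a ℕₚ.<? b)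
  count : ∀ {u u′ v v′ w w′} → ⟦ a < b ⟧ ≡ u → ⟦ b < a ⟧ ≡ u′ → ⟦ b < c ⟧ ≡ v → ⟦ c < b ⟧ ≡ v′ →
    ⟦ a < c ⟧ ≡ w → ⟦ c < a ⟧ ≡ w′ →
    isMin a b c ℕ.+ (isMin b c a ℕ.+ isMin c a b) ≡ u ℕ.* w ℕ.+ (v ℕ.* u′ ℕ.+ w′ ℕ.* v′)
  count refl refl refl refl refl refl = refl
  cases : Tri (a < b) (a ≡ b) (b < a) → Tri (b < c) (b ≡ c) (c < b) → Tri (a < c) (a ≡ c) (c < a) →
    isMin a b c ℕ.+ (isMin b c a ℕ.+ isMin c a b) ≡ 1
  cases (tri≈ _ a≡b _) _ _ = contradiction a≡b a≢b
  cases _ (tri≈ _ b≡c _) _ = contradiction b≡c b≢c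
  cases _ _ (tri≈ _ a≡c _) = contradiction a≡c a≢c
  cases (tri< a<b _ _) (tri< b<c _ _) (tri> a≮c _ _) = contradiction (ℕₚ.<-trans a<b b<c) a≮c
  cases (tri> _ _ b<a) (tri> _ _ c<b) (tri< _ _ c≮a) = contradiction (ℕₚ.<-trans c<b b<a) c≮a
  cases (tri< l _ l′) (tri< m _ m′) (tri< r _ r′) = count (yes< l) (no≮ l′) (yes< m) (no≮ m′) (yes< r) (no≮ r′)
  cases (tri< l _ l′) (tri> m _ m′) (tri< r _ r′) = count (yes< l) (no≮ l′) (no≮ m) (yes< m′) (yes< r) (no≮ r′)
  cases (tri< l _ l′) (tri> m _ m′) (tri> r _ r′) = count (yes< l) (no≮ l′) (no≮ m) (yes< m′) (no≮ r) (yes< r′)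
  cases (tri> l _ l′) (tri< m _ m′) (tri< r _ r′) = count (no≮ l) (yes< l′) (yes< m) (no≮ m′) (yes< r) (no≮ r′)
  cases (tri> l _ l′) (tri< m _ m′) (tri> r _ r′) = count (no≮ l) (yes< l′) (yes< m) (no≮ m′) (no≮ r) (yes< r′)
  cases (tri> l _ l′) (tri> m _ m′) (tri> r _ r′) = count (no≮ l) (yes< l′) (no≮ m) (yes< m′) (no≮ r) (yes< r′)

-- Every orbit of length 3 has exactly one minimum, so the non-fixed points are counted by 3 × the minima.
module OrderThree {n} (f : Fin n → Fin n) (f³ : ∀ i → f (f (f i)) ≡ i) where

  fixed : Fin n → ℕ
  fixed i = indicator (f i Finₚ.≟ i)

  minimal : Fin n → ℕ
  minimal i = isMin (toℕ i) (toℕ (f i)) (toℕ (f (f i)))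

  -- At a fixed point the strict comparisons make every `minimal` zero and only `fixed` counts.
  -- Otherwise the three points of the orbit are distinct, because any coincidence among them would
  -- force f i = i.
  orbit-count : ∀ i → 1 ≡ fixed i ℕ.+ (minimal i ℕ.+ (minimal (f i) ℕ.+ minimal (f (f i))))
  orbit-count i rewrite cong f (f³ i) | f³ i with f i Finₚ.≟ i
  ... | yes fi≡i rewrite cong f fi≡i | fi≡i = cong (λ m → suc (m ℕ.* m ℕ.+ (m ℕ.* m ℕ.+ m ℕ.* m)))
          (sym (indicator-no (toℕ i ℕₚ.<? toℕ i) (ℕₚ.<-irrefl refl)))
  ... | no fi≢i = sym (one-min
          (λ e → fi≢i (sym (Finₚ.toℕ-injective e)))
          (λ e → fi≢i (fixed-by-f (sym (Finₚ.toℕ-injective e))))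
          (λ e → fi≢i (trans (cong f (Finₚ.toℕ-injective e)) (f³ i))))
    where
    fixed-by-f : f (f i) ≡ f i → f i ≡ i
    fixed-by-f e = trans (sym e) (trans (sym (cong f e)) (f³ i))

  n≡fixed+3k : ∃ λ k → n ≡ sum fixed ℕ.+ 3 ℕ.* k
  n≡fixed+3k = sum minimal , (begin
    n                                                      ≡⟨ sym (sum-ones n) ⟩
    sum {n} (λ _ → 1)                                      ≡⟨ sum-cong-≗ orbit-count ⟩
    sum (λ i → fixed i ℕ.+ (minimal i ℕ.+ (minimal (f i) ℕ.+ minimal (f (f i)))))
      ≡⟨ trans (∑-distrib-+ fixed _) (cong (sum fixed ℕ.+_) (trans (∑-distrib-+ minimal _) (cong (sum minimal ℕ.+_) (∑-distrib-+ (λ i → minimal (f i)) (λ i → minimal (f (f i))))))) ⟩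
    sum fixed ℕ.+ (sum minimal ℕ.+ (sum (λ i → minimal (f i)) ℕ.+ sum (λ i → minimal (f (f i)))))
      -- Reindexing along `f` preserves the total, so the three sums of minima coincide.
      ≡⟨ cong₂ (λ s t → sum fixed ℕ.+ (sum minimal ℕ.+ (s ℕ.+ t)))
           (sym (sum-permute minimal π)) (sym (trans (sum-permute minimal π) (sum-permute (λ i → minimal (f i)) π))) ⟩
    sum fixed ℕ.+ (sum minimal ℕ.+ (sum minimal ℕ.+ sum minimal))
      ≡⟨ cong (λ s → sum fixed ℕ.+ (sum minimal ℕ.+ (sum minimal ℕ.+ s))) (sym (ℕₚ.+-identityʳ (sum minimal))) ⟩
    sum fixed ℕ.+ 3 ℕ.* sum minimal ∎)
    where
    π = permutation f (λ i → f (f i)) f³ f³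
    sum-ones : ∀ n → sum {n} (λ _ → 1) ≡ n
    sum-ones zero    = refl
    sum-ones (suc n) = cong suc (sum-ones n)

-- Arithmetic of residues modulo p, and the two maps of order three.

module Residues {n : ℕ} (isPrime : Prime (suc n)) where

  open Localisation isPrime

  p : ℕ
  p = suc n

  residue : ℤ → Fin p
  residue z = fromℕ< (n%ℕd<d z p)

  ∣z-residue : ∀ z → + p ∣ z ℤ.- + toℕ (residue z)
  ∣z-residue z = divides (z /ℕ p) (begin
    z ℤ.- + toℕ (residue z)   ≡⟨ cong (λ r → z ℤ.- + r) (Finₚ.toℕ-fromℕ< (n%ℕd<d z p)) ⟩
    z ℤ.- + (z %ℕ p)          ≡⟨ cong (ℤ._- + (z %ℕ p)) (a≡a%ℕn+[a/ℕn]*n z p) ⟩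
    + (z %ℕ p) ℤ.+ (z /ℕ p) ℤ.* + p ℤ.- + (z %ℕ p)  ≡⟨ lem (+ (z %ℕ p)) ((z /ℕ p) ℤ.* + p) ⟩
    (z /ℕ p) ℤ.* + p          ∎)
    where
    lem : ∀ r k → r ℤ.+ k ℤ.- r ≡ k
    lem = ℤ-Solver.solve-∀

  toℤ : Fin p → ℤ
  toℤ i = + toℕ i

  toℤ-injective-mod : ∀ i j → + p ∣ toℤ i ℤ.- toℤ j → i ≡ j
  toℤ-injective-mod i j p∣ with i Finₚ.≟ j
  ... | yes i≡j = i≡j
  ... | no  i≢j = contradiction p∣ (p∤difference (Finₚ.toℕ<n i) (Finₚ.toℕ<n j) (λ e → i≢j (Finₚ.toℕ-injective e)))

  %ℕ≡0⇒∣ : ∀ z → z %ℕ p ≡ 0 → + p ∣ z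
  %ℕ≡0⇒∣ z eq = divides (z /ℕ p) (trans (a≡a%ℕn+[a/ℕn]*n z p)
    (trans (cong (λ r → + r ℤ.+ (z /ℕ p) ℤ.* + p) eq) (ℤₚ.+-identityˡ _)))

  ∣⇒%ℕ≡0 : ∀ z → + p ∣ z → z %ℕ p ≡ 0
  ∣⇒%ℕ≡0 z p∣z with z %ℕ p ℕₚ.≟ 0
  ... | yes eq = eq
  ... | no neq = contradiction (subst (+ p ∣_) (lem z (+ toℕ (residue z))) (ℤ∣.∣m∣n⇒∣m-n p∣z (∣z-residue z)))
    (λ p∣r → ∤-small {+ toℕ (residue z)} (Finₚ.toℕ<n (residue z)) (λ e → neq (trans (sym (Finₚ.toℕ-fromℕ< (n%ℕd<d z p))) (ℤₚ.+-injective e))) p∣r)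
    where
    lem : ∀ z r → z ℤ.- (z ℤ.- r) ≡ r
    lem = ℤ-Solver.solve-∀

  sum-zero : ∀ {n} {g : Fin n → ℕ} → (∀ i → g i ≡ 0) → sum g ≡ 0
  sum-zero {n} g≡0 = trans (sum-cong-≗ g≡0) (sum-replicate-zero n)

  -- A primitive cube root of unity ω makes i ↦ ω i a permutation of order 3 whose only fixed point is 0.
  module CubeRoot (ω : ℤ) (p∤3 : ¬ (+ p ∣ + 3)) (ω²+ω+1 : + p ∣ ω ℤ.* ω ℤ.+ ω ℤ.+ + 1) where

    f : Fin p → Fin p
    f i = residue (ω ℤ.* toℤ i)

    f³ : ∀ i → f (f (f i)) ≡ i
    f³ i = toℤ-injective-mod (f (f (f i))) i (subst (+ p ∣_) (lem ω (toℤ i) (toℤ (f i)) (toℤ (f (f i))) (toℤ (f (f (f i)))))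
      (ℤ∣.∣m∣n⇒∣m-n (ℤ∣.∣m∣n⇒∣m-n (ℤ∣.∣m∣n⇒∣m-n (ℤ∣.∣n⇒∣m*n ((ω ℤ.- + 1) ℤ.* toℤ i) ω²+ω+1)
        (ℤ∣.∣n⇒∣m*n (ω ℤ.* ω) (∣z-residue (ω ℤ.* toℤ i))))
        (ℤ∣.∣n⇒∣m*n ω (∣z-residue (ω ℤ.* toℤ (f i)))))
        (∣z-residue (ω ℤ.* toℤ (f (f i))))))
      where
      -- ω³ - 1 = (ω - 1)(ω² + ω + 1); the other three summands are the errors of the successive
      -- reductions modulo `p`.
      lem : ∀ ω i a b c → (ω ℤ.- + 1) ℤ.* i ℤ.* (ω ℤ.* ω ℤ.+ ω ℤ.+ + 1) ℤ.- ω ℤ.* ω ℤ.* (ω ℤ.* i ℤ.- a)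
        ℤ.- ω ℤ.* (ω ℤ.* a ℤ.- b) ℤ.- (ω ℤ.* b ℤ.- c) ≡ c ℤ.- i
      lem = ℤ-Solver.solve-∀

    open OrderThree f f³

    -- ω ≡ 1 would turn ω² + ω + 1 into 3.
    p∤ω-1 : ¬ (+ p ∣ ω ℤ.- + 1)
    p∤ω-1 p∣ = p∤3 (subst (+ p ∣_) (lem ω) (ℤ∣.∣m∣n⇒∣m-n ω²+ω+1 (ℤ∣.∣n⇒∣m*n (ω ℤ.+ + 2) p∣)))
      where
      lem : ∀ ω → ω ℤ.* ω ℤ.+ ω ℤ.+ + 1 ℤ.- (ω ℤ.+ + 2) ℤ.* (ω ℤ.- + 1) ≡ + 3
      lem = ℤ-Solver.solve-∀

    fixed⇒0 : ∀ i → f i ≡ i → i ≡ zero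
    fixed⇒0 i fi≡i with euclid (ω ℤ.- + 1) (toℤ i) (subst (+ p ∣_) (lem ω (toℤ i))
      (subst (λ j → + p ∣ ω ℤ.* toℤ i ℤ.- toℤ j) fi≡i (∣z-residue (ω ℤ.* toℤ i))))
      where
      lem : ∀ ω i → ω ℤ.* i ℤ.- i ≡ (ω ℤ.- + 1) ℤ.* i
      lem = ℤ-Solver.solve-∀
    ... | inj₁ p∣ω-1 = contradiction p∣ω-1 p∤ω-1
    ... | inj₂ p∣i   = toℤ-injective-mod i zero (subst (+ p ∣_) (sym (ℤₚ.+-identityʳ (toℤ i))) p∣i)

    f0≡0 : f zero ≡ zero
    f0≡0 = toℤ-injective-mod (f zero) zero (subst (+ p ∣_) (lem ω (toℤ (f zero)))
      (ℤ∣.∣m⇒∣-m (∣z-residue (ω ℤ.* toℤ zero))))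
      where
      lem : ∀ ω z → ℤ.- (ω ℤ.* + 0 ℤ.- z) ≡ z ℤ.- + 0
      lem = ℤ-Solver.solve-∀

    p≡1+3k : ∃ λ k → p ≡ 1 ℕ.+ 3 ℕ.* k
    p≡1+3k = proj₁ n≡fixed+3k , trans (proj₂ n≡fixed+3k) (cong (ℕ._+ 3 ℕ.* proj₁ n≡fixed+3k) (cong₂ ℕ._+_
      (indicator-yes (f zero Finₚ.≟ zero) f0≡0)
      (sum-zero (λ i → indicator-no (f (suc i) Finₚ.≟ suc i) (λ e → 0≢suc (fixed⇒0 (suc i) e))))))
      where
      0≢suc : ∀ {i : Fin n} → Fin.suc i ≢ zero
      0≢suc ()

  -- Since 2h ≡ -1, the witness `ω = h (1 - x)` is (-1 + x)/2 modulo `p`, the usual cube root of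
  -- unity with x as √-3, and 4(ω² + ω + 1) ≡ x² + 3.
  x²+3⇒p≡1+3k : ∀ {h} x → p ≡ suc (2 ℕ.* h) → ¬ (+ p ∣ + 2) → ¬ (+ p ∣ + 3) → + p ∣ x ℤ.* x ℤ.+ + 3 →
    ∃ λ k → p ≡ 1 ℕ.+ 3 ℕ.* k
  x²+3⇒p≡1+3k {h} x p≡ p∤2 p∤3 p∣x²+3 = CubeRoot.p≡1+3k ω p∤3
    ([ (λ p∣4 → contradiction p∣4 (∤-* {+ 2} {+ 2} p∤2 p∤2)) , (λ d → d) ]′ (euclid (+ 4) _
      (subst (+ p ∣_)
        (trans (cong (λ P → x ℤ.* x ℤ.+ + 3 ℤ.+ P ℤ.* ((+ 1 ℤ.- x) ℤ.* (+ 2 ℤ.* x ℤ.+ P ℤ.* (+ 1 ℤ.- x)))) pℤ) (lem x (+ h)))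
        (ℤ∣.∣m∣n⇒∣m+n p∣x²+3 (ℤ∣.∣m⇒∣m*n ((+ 1 ℤ.- x) ℤ.* (+ 2 ℤ.* x ℤ.+ + p ℤ.* (+ 1 ℤ.- x))) (ℤ∣.∣-refl {+ p}))))))
    where
    ω = + h ℤ.* (+ 1 ℤ.- x)
    pℤ : + p ≡ + 1 ℤ.+ + 2 ℤ.* + h
    pℤ = trans (cong +_ p≡) (cong (λ z → + 1 ℤ.+ z) (ℤₚ.pos-* 2 h))
    lem : ∀ x h → x ℤ.* x ℤ.+ + 3 ℤ.+ (+ 1 ℤ.+ + 2 ℤ.* h) ℤ.* ((+ 1 ℤ.- x) ℤ.* (+ 2 ℤ.* x ℤ.+ (+ 1 ℤ.+ + 2 ℤ.* h) ℤ.* (+ 1 ℤ.- x))) ≡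
      + 4 ℤ.* ((h ℤ.* (+ 1 ℤ.- x)) ℤ.* (h ℤ.* (+ 1 ℤ.- x)) ℤ.+ h ℤ.* (+ 1 ℤ.- x) ℤ.+ + 1)
    lem = ℤ-Solver.solve-∀

  -- Bézout's identity is applied to the absolute value of `z`; the cofactor of `z` in it restores
  -- the sign.
  inverse : ∀ z → ¬ (+ p ∣ z) → ∃ λ w → + p ∣ z ℤ.* w ℤ.- + 1
  inverse z p∤z = signed (ℤ.∣ z ∣) (λ p∣ → p∤z (∣ᵤ⇒∣ p∣)) (ℤ∣.m∣∣m∣ {z})
    where
    bézout : ∀ a → ¬ (p ℕ∣.∣ a) → ∃ λ w → + p ∣ + a ℤ.* w ℤ.- + 1
    bézout a p∤a with coprime-Bézout (∤⇒coprime p∤a)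
    ... | Bézout.+- x y eq = + x , divides (+ y) (trans (cong (λ v → v ℤ.- + 1) (trans (ℤₚ.*-comm (+ a) (+ x)) (trans (sym (ℤₚ.pos-* x a)) (cong +_ (sym eq)))))
      (trans (lem (+ (y ℕ.* p))) (ℤₚ.pos-* y p)))
      where
      lem : ∀ v → + 1 ℤ.+ v ℤ.- + 1 ≡ v
      lem = ℤ-Solver.solve-∀
    ... | Bézout.-+ x y eq = ℤ.- + x , divides (ℤ.- + y) (trans (lem (+ a) (+ x)) (trans (cong (λ v → ℤ.- (+ 1 ℤ.+ v)) (sym (ℤₚ.pos-* x a)))
      (trans (cong (λ v → ℤ.- + v) eq) (trans (cong ℤ.-_ (ℤₚ.pos-* y p)) (ℤₚ.neg-distribˡ-* (+ y) (+ p))))))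
      where
      lem : ∀ a x → a ℤ.* ℤ.- x ℤ.- + 1 ≡ ℤ.- (+ 1 ℤ.+ x ℤ.* a)
      lem = ℤ-Solver.solve-∀
    signed : ∀ a → ¬ (p ℕ∣.∣ a) → z ∣ + a → ∃ λ w → + p ∣ z ℤ.* w ℤ.- + 1
    signed a p∤a (divides c eq) = c ℤ.* proj₁ (bézout a p∤a) , subst (+ p ∣_)
      (cong (ℤ._- + 1) (trans (cong (ℤ._* proj₁ (bézout a p∤a)) eq) (lem c z (proj₁ (bézout a p∤a))))) (proj₂ (bézout a p∤a))
      where
      lem : ∀ c z w → c ℤ.* z ℤ.* w ≡ z ℤ.* (c ℤ.* w)
      lem = ℤ-Solver.solve-∀

-- The map i ↦ 1/(1-i) has order 3; apart from 0 and 1, which are kept fixed here,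
-- its fixed points are the roots of i² - i + 1.
module Reciprocal {m : ℕ} (isPrime : Prime (suc (suc m)))
  (noRoot : ∀ x → ¬ (+ suc (suc m) ∣ x ℤ.* x ℤ.+ + 3)) where

  open Localisation isPrime
  open Residues isPrime

  p∤1-i : ∀ j → ¬ (+ p ∣ + 1 ℤ.- toℤ (suc (suc j)))
  p∤1-i j p∣ with toℤ-injective-mod (suc zero) (suc (suc j)) p∣
  ... | ()

  f : Fin p → Fin p
  f zero          = zero
  f (suc zero)    = suc zero
  f (suc (suc j)) = residue (proj₁ (inverse (+ 1 ℤ.- toℤ (suc (suc j))) (p∤1-i j)))

  [1-i]*fi≡1 : ∀ j → + p ∣ (+ 1 ℤ.- toℤ (suc (suc j))) ℤ.* toℤ (f (suc (suc j))) ℤ.- + 1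
  [1-i]*fi≡1 j = subst (+ p ∣_) (lem z w (toℤ (f (suc (suc j)))))
    (ℤ∣.∣m∣n⇒∣m-n (proj₂ z⁻¹) (ℤ∣.∣n⇒∣m*n z (∣z-residue w)))
    where
    z = + 1 ℤ.- toℤ (suc (suc j))
    z⁻¹ = inverse z (p∤1-i j)
    w = proj₁ z⁻¹
    lem : ∀ z w r → z ℤ.* w ℤ.- + 1 ℤ.- z ℤ.* (w ℤ.- r) ≡ z ℤ.* r ℤ.- + 1
    lem = ℤ-Solver.solve-∀

  data ≥2 : Fin p → Set where
    ≥2-suc : ∀ j → ≥2 (suc (suc j))

  -- A reciprocal is never 0, and 1/(1-i) = 1 only for i = 0.
  fi≥2 : ∀ {i} → ≥2 i → ≥2 (f i)
  fi≥2 (≥2-suc j) = cases (f (suc (suc j))) ([1-i]*fi≡1 j)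
    where
    I = toℤ (suc (suc j))
    lem₀ : ∀ i → ℤ.- ((+ 1 ℤ.- i) ℤ.* + 0 ℤ.- + 1) ≡ + 1
    lem₀ = ℤ-Solver.solve-∀
    lem₁ : ∀ i → ℤ.- ((+ 1 ℤ.- i) ℤ.* + 1 ℤ.- + 1) ≡ i
    lem₁ = ℤ-Solver.solve-∀
    cases : ∀ y → + p ∣ (+ 1 ℤ.- I) ℤ.* toℤ y ℤ.- + 1 → ≥2 y
    cases zero          p∣ = contradiction (subst (+ p ∣_) (lem₀ I) (ℤ∣.∣m⇒∣-m p∣)) p∤1
    cases (suc zero)    p∣ = contradiction (subst (+ p ∣_) (lem₁ I) (ℤ∣.∣m⇒∣-m p∣))
                               (∤-small {I} (Finₚ.toℕ<n (suc (suc j))) (λ ()))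
    cases (suc (suc y)) p∣ = ≥2-suc y

  reciprocal : ∀ {i} → ≥2 i → + p ∣ (+ 1 ℤ.- toℤ i) ℤ.* toℤ (f i) ℤ.- + 1
  reciprocal (≥2-suc j) = [1-i]*fi≡1 j

  f³ : ∀ i → f (f (f i)) ≡ i
  f³ zero       = refl
  f³ (suc zero) = refl
  f³ i@(suc (suc j)) = toℤ-injective-mod (f (f (f i))) i
    (subst (+ p ∣_) (lem (toℤ i) (toℤ (f i)) (toℤ (f (f i))) (toℤ (f (f (f i)))))
      (ℤ∣.∣m∣n⇒∣m-n
        (ℤ∣.∣n⇒∣m*n x (reciprocal x≥2′′))
        (ℤ∣.∣n⇒∣m*n w (ℤ∣.∣m∣n⇒∣m-n (ℤ∣.∣n⇒∣m*n z (reciprocal x≥2)) (ℤ∣.∣n⇒∣m*n (x ℤ.- + 1) (reciprocal x≥2′))))))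
    where
    x = toℤ i
    z = toℤ (f (f i))
    w = toℤ (f (f (f i)))
    x≥2 = ≥2-suc j
    x≥2′ = fi≥2 x≥2
    x≥2′′ = fi≥2 x≥2′
    -- The inner difference eliminates y and equals x - 1 - xz, so the second iterate is (x-1)/x;
    -- together with (1-z)w ≡ 1 this gives w ≡ x.
    lem : ∀ x y z w → x ℤ.* ((+ 1 ℤ.- z) ℤ.* w ℤ.- + 1)
      ℤ.- w ℤ.* (z ℤ.* ((+ 1 ℤ.- x) ℤ.* y ℤ.- + 1) ℤ.- (x ℤ.- + 1) ℤ.* ((+ 1 ℤ.- y) ℤ.* z ℤ.- + 1)) ≡ w ℤ.- x
    lem = ℤ-Solver.solve-∀

  open OrderThree f f³

  -- Completing the square: 4(i² - i + 1) = (2i - 1)² + 3, so a fixed point would produce a square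
  -- root of -3.
  f-moves : ∀ j → f (suc (suc j)) ≢ suc (suc j)
  f-moves j fi≡i = noRoot (+ 2 ℤ.* i ℤ.- + 1) (subst (+ p ∣_) (lem i)
    (ℤ∣.∣n⇒∣m*n (ℤ.- + 4) (subst (λ y → + p ∣ (+ 1 ℤ.- i) ℤ.* toℤ y ℤ.- + 1) fi≡i ([1-i]*fi≡1 j))))
    where
    i = toℤ (suc (suc j))
    lem : ∀ i → ℤ.- + 4 ℤ.* ((+ 1 ℤ.- i) ℤ.* i ℤ.- + 1) ≡ (+ 2 ℤ.* i ℤ.- + 1) ℤ.* (+ 2 ℤ.* i ℤ.- + 1) ℤ.+ + 3
    lem = ℤ-Solver.solve-∀

  p≡2+3k : ∃ λ k → p ≡ 2 ℕ.+ 3 ℕ.* k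
  p≡2+3k = proj₁ n≡fixed+3k , trans (proj₂ n≡fixed+3k) (cong (ℕ._+ 3 ℕ.* proj₁ n≡fixed+3k)
    (cong (λ s → 2 ℕ.+ s) (sum-zero (λ j → indicator-no (f (suc (suc j)) Finₚ.≟ suc (suc j)) (f-moves j)))))

χ-3k : ∀ k → χ (3 ℕ.* k) ≡ + 1
χ-3k zero    = refl
χ-3k (suc k) = trans (cong χ (ℕₚ.*-suc 3 k)) (χ-3k k)

χ-3k+2 : ∀ k → χ (2 ℕ.+ 3 ℕ.* k) ≡ -[1+ 0 ]
χ-3k+2 zero    = refl
χ-3k+2 (suc k) = trans (cong χ (trans (cong (2 ℕ.+_) (ℕₚ.*-suc 3 k)) (ℕ-lem (3 ℕ.* k)))) (χ-3k+2 k)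
  where
  ℕ-lem : ∀ m → 2 ℕ.+ (3 ℕ.+ m) ≡ 3 ℕ.+ (2 ℕ.+ m)
  ℕ-lem m = refl

1+3k≢2+3j : ∀ k j → 1 ℕ.+ 3 ℕ.* k ≢ 2 ℕ.+ 3 ℕ.* j
1+3k≢2+3j k j eq = 1≢2 (trans (sym (mod3 1 k)) (trans (cong (_% 3) eq) (mod3 2 j)))
  where
  1≢2 : 1 ≢ 2
  1≢2 ()
  mod3 : ∀ r k → (r ℕ.+ 3 ℕ.* k) % 3 ≡ r % 3
  mod3 r k = trans (cong (λ m → (r ℕ.+ m) % 3) (ℕₚ.*-comm 3 k)) ([m+kn]%n≡m%n r k 3)

module MinusThree {n : ℕ} (isPrime : Prime (suc n)) (3<p : 3 < suc n) where

  open Localisation isPrime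
  open Residues isPrime

  p∤2 : ¬ (+ p ∣ + 2)
  p∤2 = ∤-small {+ 2} (ℕₚ.<-trans (ℕₚ.n<1+n 2) 3<p) (λ ())

  p∤3 : ¬ (+ p ∣ + 3)
  p∤3 = ∤-small {+ 3} 3<p (λ ())

  -3≢0 : -[1+ 2 ] %ℕ p ≢ 0
  -3≢0 eq = p∤3 (ℤ∣.∣m⇒∣-m (%ℕ≡0⇒∣ -[1+ 2 ] eq))

  -- If -3 had no root, `Reciprocal` would put `p` in the class 2 modulo 3.
  legendre-1mod3 : ∀ k → p ≡ 1 ℕ.+ 3 ℕ.* k → legendre -[1+ 2 ] p ≡ + 1
  legendre-1mod3 k p≡ = legendre≡+1 -[1+ 2 ] n -3≢0 (λ none → root-exists isPrime refl (λ x p∣x²+3 →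
    none (toℕ (residue x)) (Finₚ.toℕ<n (residue x)) (∣⇒%ℕ≡0 _ (subst (+ p ∣_) (lem x (toℤ (residue x)))
      (ℤ∣.∣m∣n⇒∣m-n p∣x²+3 (ℤ∣.∣n⇒∣m*n (x ℤ.+ toℤ (residue x)) (∣z-residue x)))))))
    where
    lem : ∀ x r → x ℤ.* x ℤ.+ + 3 ℤ.- (x ℤ.+ r) ℤ.* (x ℤ.- r) ≡ r ℤ.* r ℤ.- -[1+ 2 ]
    lem = ℤ-Solver.solve-∀
    -- `n` is generalised to `m` so that it can be split: `Reciprocal` needs both 0 and 1 among the
    -- residues.
    root-exists : ∀ {m} → Prime (suc m) → n ≡ m → ¬ (∀ x → ¬ (+ p ∣ x ℤ.* x ℤ.+ + 3))
    root-exists {zero}  _ refl _ = p∤1 (ℤ∣.∣-refl {+ 1})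
    root-exists {suc m} isPrime refl noRoot = 1+3k≢2+3j k (proj₁ q) (trans (sym p≡) (proj₂ q))
      where q = Reciprocal.p≡2+3k isPrime noRoot

  legendre-2mod3 : ∀ h k → p ≡ suc (2 ℕ.* h) → p ≡ 2 ℕ.+ 3 ℕ.* k → legendre -[1+ 2 ] p ≡ -[1+ 0 ]
  legendre-2mod3 h k p≡₁ p≡₂ = legendre≡-1 -[1+ 2 ] n -3≢0 (λ x _ eq →
    let q = x²+3⇒p≡1+3k {h} (+ x) p≡₁ p∤2 p∤3 (%ℕ≡0⇒∣ _ eq)
    in 1+3k≢2+3j (proj₁ q) k (trans (sym (proj₂ q)) p≡₂))

-- The class of p modulo 6, and the conclusion.

-- The two forms exhibit (p-1)/2 as 3k or 2+3k, the arguments at which `χ` is known.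
prime-mod-6 : ∀ {p} → Prime p → 3 < p → ∃ λ k → (p ≡ suc (2 ℕ.* (3 ℕ.* k))) ⊎ (p ≡ suc (2 ℕ.* (2 ℕ.+ 3 ℕ.* k)))
prime-mod-6 {p} isPrime 3<p = p ℕ./ 6 , cases (p % 6) (m%n<n p 6) (m≡m%n+[m/n]*n p 6)
  where
  k = p ℕ./ 6
  only : ∀ d → d ≢ 1 → d ≤ 3 → ∀ m → p ≢ m ℕ.* d
  only d d≢1 d≤3 m eq with prime⇒irreducible isPrime (ℕ∣.divides m eq)
  ... | inj₁ d≡1 = d≢1 d≡1
  ... | inj₂ d≡p = ℕₚ.<⇒≱ 3<p (subst (_≤ 3) d≡p d≤3)
  cases : ∀ r → r < 6 → p ≡ r ℕ.+ k ℕ.* 6 → (p ≡ suc (2 ℕ.* (3 ℕ.* k))) ⊎ (p ≡ suc (2 ℕ.* (2 ℕ.+ 3 ℕ.* k)))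
  cases 0 _ eq = contradiction (trans eq (lem k)) (only 2 (λ ()) (ℕₚ.n≤1+n 2) (3 ℕ.* k))
    where
    lem : ∀ k → k ℕ.* 6 ≡ 3 ℕ.* k ℕ.* 2
    lem = ℕ-Solver.solve-∀
  cases 1 _ eq = inj₁ (trans eq (lem k))
    where
    lem : ∀ k → 1 ℕ.+ k ℕ.* 6 ≡ 1 ℕ.+ 2 ℕ.* (3 ℕ.* k)
    lem = ℕ-Solver.solve-∀
  cases 2 _ eq = contradiction (trans eq (lem k)) (only 2 (λ ()) (ℕₚ.n≤1+n 2) (1 ℕ.+ 3 ℕ.* k))
    where
    lem : ∀ k → 2 ℕ.+ k ℕ.* 6 ≡ (1 ℕ.+ 3 ℕ.* k) ℕ.* 2
    lem = ℕ-Solver.solve-∀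
  cases 3 _ eq = contradiction (trans eq (lem k)) (only 3 (λ ()) ℕₚ.≤-refl (1 ℕ.+ 2 ℕ.* k))
    where
    lem : ∀ k → 3 ℕ.+ k ℕ.* 6 ≡ (1 ℕ.+ 2 ℕ.* k) ℕ.* 3
    lem = ℕ-Solver.solve-∀
  cases 4 _ eq = contradiction (trans eq (lem k)) (only 2 (λ ()) (ℕₚ.n≤1+n 2) (2 ℕ.+ 3 ℕ.* k))
    where
    lem : ∀ k → 4 ℕ.+ k ℕ.* 6 ≡ (2 ℕ.+ 3 ℕ.* k) ℕ.* 2
    lem = ℕ-Solver.solve-∀
  cases 5 _ eq = inj₂ (trans eq (lem k))
    where
    lem : ∀ k → 5 ℕ.+ k ℕ.* 6 ≡ 1 ℕ.+ 2 ℕ.* (2 ℕ.+ 3 ℕ.* k)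
    lem = ℕ-Solver.solve-∀
  cases (suc (suc (suc (suc (suc (suc r)))))) r<6 _ = contradiction r<6 (ℕₚ.m+n≮m 6 r)

sum≡p*legendre : ∀ h q (isPrime : Prime (suc (2 ℕ.* h))) (3<p : 3 < suc (2 ℕ.* h)) →
  + suc (2 ℕ.* h) ∣ (+ 6 ℤ.* + q) ℤ.* (+ 6 ℤ.* + q) ℤ.- + 1 →
  χ h ≡ legendre -[1+ 2 ] (suc (2 ℕ.* h)) →
  sumℚ (suc (2 ℕ.* h)) (λ k → summand k * ℕ→ℚ (8 ℕ.* k ℕ.+ 1)) ≡
    ((+ suc (2 ℕ.* h)) ℤ.* legendre -[1+ 2 ] (suc (2 ℕ.* h))) / 1 [modℚ suc (2 ℕ.* h) ^ 3 ]
sum≡p*legendre h q isPrime 3<p q-inverts-6 χ≡ = ∈⟨p^k⟩⇒≡-mod {sumℚ p (λ k → summand k * ℕ→ℚ (8 ℕ.* k ℕ.+ 1))} {ι (+ p ℤ.* legendre -[1+ 2 ] p)} 3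
  (subst₂ _∈⟨_⟩ (cong₂ _-_ (sym (sum≡series p))
      (trans (cong (λ c → P * ι c) χ≡) (sym (ι-* (+ p) (legendre -[1+ 2 ] p))))) P³≡ series-0-≡-mod)
  where
  open Congruence h q isPrime 3<p q-inverts-6
  open Localisation isPrime
  P³≡ : P * (P * P) ≡ ℕ→ℚ (p ^ 3)
  P³≡ = sym (trans (cong (λ m → ℕ→ℚ (p ℕ.* (p ℕ.* m))) (ℕₚ.*-identityʳ p))
    (trans (ℕ→ℚ-* p (p ℕ.* p)) (cong (P *_) (ℕ→ℚ-* p p))))

theorem2 : (p : ℕ) → Prime p → 3 < p →
    sumℚ p (λ k →
    (poch (+ 1 / 4) k ℚ.* poch (+ 1 / 2) k ℚ.* poch (+ 3 / 4) k
    ℚ.* ((invFact k ^ℚ 3) ℚ.* ((+ 1 / 9) ^ℚ k)))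
    ℚ.* ℕ→ℚ (8 ℕ.* k ℕ.+ 1))
    ≡ (((+ p) ℤ.* legendre -[1+ 2 ] p) / 1) [modℚ p ^ 3 ]
theorem2 p isPrime 3<p with prime-mod-6 isPrime 3<p
-- Here p = 6k+1, and q = k works because 6k ≡ -1.
... | k , inj₁ refl = sum≡p*legendre (3 ℕ.* k) k isPrime 3<p
  (divides (+ 6 ℤ.* + k ℤ.- + 1) (trans (lem (+ k)) (cong ((+ 6 ℤ.* + k ℤ.- + 1) ℤ.*_) (sym pℤ))))
  (trans (χ-3k k) (sym (MinusThree.legendre-1mod3 isPrime 3<p (2 ℕ.* k) (ℕ-lem k))))
  where
  lem : ∀ k → (+ 6 ℤ.* k) ℤ.* (+ 6 ℤ.* k) ℤ.- + 1 ≡ (+ 6 ℤ.* k ℤ.- + 1) ℤ.* (+ 1 ℤ.+ + 6 ℤ.* k)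
  lem = ℤ-Solver.solve-∀
  ℕ-lem₂ : ∀ k → 1 ℕ.+ 2 ℕ.* (3 ℕ.* k) ≡ 1 ℕ.+ 6 ℕ.* k
  ℕ-lem₂ = ℕ-Solver.solve-∀
  pℤ : + suc (2 ℕ.* (3 ℕ.* k)) ≡ + 1 ℤ.+ + 6 ℤ.* + k
  pℤ = trans (cong +_ (ℕ-lem₂ k)) (cong (λ z → + 1 ℤ.+ z) (ℤₚ.pos-* 6 k))
  ℕ-lem : ∀ k → 1 ℕ.+ 2 ℕ.* (3 ℕ.* k) ≡ 1 ℕ.+ 3 ℕ.* (2 ℕ.* k)
  ℕ-lem = ℕ-Solver.solve-∀
-- Here p = 6k+5, and q = k+1 works because 6(k+1) = p+1.
... | k , inj₂ refl = sum≡p*legendre (2 ℕ.+ 3 ℕ.* k) (suc k) isPrime 3<p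
  (divides (+ 6 ℤ.* + suc k ℤ.+ + 1) (trans (lem (+ suc k)) (cong ((+ 6 ℤ.* + suc k ℤ.+ + 1) ℤ.*_) (sym pℤ))))
  (trans (χ-3k+2 k) (sym (MinusThree.legendre-2mod3 isPrime 3<p (2 ℕ.+ 3 ℕ.* k) (1 ℕ.+ 2 ℕ.* k) refl (ℕ-lem k))))
  where
  lem : ∀ k → (+ 6 ℤ.* k) ℤ.* (+ 6 ℤ.* k) ℤ.- + 1 ≡ (+ 6 ℤ.* k ℤ.+ + 1) ℤ.* (+ 6 ℤ.* k ℤ.- + 1)
  lem = ℤ-Solver.solve-∀
  ℕ-lem₂ : ∀ k → 6 ℕ.* (1 ℕ.+ k) ≡ 1 ℕ.+ (1 ℕ.+ 2 ℕ.* (2 ℕ.+ 3 ℕ.* k))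
  ℕ-lem₂ = ℕ-Solver.solve-∀
  pℤ : + suc (2 ℕ.* (2 ℕ.+ 3 ℕ.* k)) ≡ + 6 ℤ.* + suc k ℤ.- + 1
  pℤ = sym (cong (λ z → z ℤ.- + 1) (trans (sym (ℤₚ.pos-* 6 (suc k))) (cong +_ (ℕ-lem₂ k))))
  ℕ-lem : ∀ k → 1 ℕ.+ 2 ℕ.* (2 ℕ.+ 3 ℕ.* k) ≡ 2 ℕ.+ 3 ℕ.* (1 ℕ.+ 2 ℕ.* k)
  ℕ-lem = ℕ-Solver.solve-∀
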